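{- Let $t\ge 1$ be an integer. Let $G$ be an ordered graph with $n\ge 2$ vertices, let $a>0$ be a real number, and let $e\in E(G)$ satisfy $\mathrm{h}_G(e)>a$. Then there is an increasing path $P$ in $G$ starting with $e$ and having length at least $$\frac{a^{1-1/t}}{(70\log n)^{2t}},$$ such that $\mathrm{h}_G(f)\ge \mathrm{h}_G(e)-a$ for every $f\in E(P)$.
   Context: An ordered graph is a finite simple graph $G$ equipped with a total order $\le_G$ on $E(G)$ and a total order $\le^V_G$ on $V(G)$. Let $\mathbb N=\{1,2,\dots\}$. Define the lexicographic order $\preceq_{\mathrm{lex}}$ on $\mathbb N\times V(G)$ by $(i,v)\preceq_{\mathrm{lex}}(i',v')$ iff $i<i'$, or $i=i'$ and $v\le^V_G v'$. The height table $\mathrm{HT}(G)$ is a partially filled array indexed by $\mathbb N\times V(G)$, built by going through all $(i,v)\in\mathbb N\times V(G)$ in $\preceq_{\mathrm{lex}}$-increasing order and setting the entry at $(i,v)$ to be the $\le_G$-largest edge containing $v$ that has not yet been entered into the table (leaving the entry blank if every edge containing $v$ has already been entered). Every edge is entered exactly once; for $e\in E(G)$, $\mathrm{ht}_G(e)=(\mathrm{h}_G(e),\mathrm{v}_G(e))$ denotes its position, where the height $\mathrm{h}_G(e)$ is its row and $\mathrm{v}_G(e)$ its column (a vertex of $e$). An increasing path is a path with a specified direction whose consecutive edges are $\le_G$-increasing; its length is its number of edges; "starting with $e$" means $e$ is its first edge. Logarithms are base 2. -}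

module Defs where

open import Data.Bool.Base using (Bool; false; T; if_then_else_)
open import Data.Empty using (⊥-elim; ⊥-elim-irr)
open import Data.Fin.Base as Fin using (Fin)
import Data.Fin.Properties as Fin
open import Data.Integer.Base as ℤ using (+_; -[1+_])
import Data.Integer.Properties as ℤ
open import Data.List.Base using (List; []; _∷_; length; filter; last; foldl; concatMap; allFin)
open import Data.List.Membership.Propositional using (_∈_; lose)
open import Data.List.Membership.Propositional.Properties using (∈-allFin; ∈-concatMap⁺; ∈-filter⁺; ∈-filter⁻)
open import Data.List.Properties using (length-filter; filter-notAll)
open import Data.List.Relation.Binary.Permutation.Propositional using (↭-sym; ↭⇒↭ₛ)
open import Data.List.Relation.Binary.Permutation.Propositional.Properties using (∈-resp-↭)
open import Data.List.Relation.Unary.All as All using ()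
open import Data.List.Relation.Unary.AllPairs using (_∷_)
open import Data.List.Relation.Unary.Any using (here; there)
open import Data.List.Relation.Unary.Linked using (Linked)
open import Data.List.Relation.Unary.Unique.Propositional using (Unique)
open import Data.List.Relation.Unary.Unique.Propositional.Properties using (allFin⁺)
import Data.List.Relation.Binary.Permutation.Setoid.Properties as Permutation
import Data.List.Sort as Sort
open import Data.Maybe.Base using (Maybe; just; nothing; maybe′)
open import Data.Nat.Base as ℕ using (ℕ; zero; suc)
import Data.Nat.Coprimality as Coprime
import Data.Nat.Properties as ℕ
open import Data.Product.Base using (∃; ∃-syntax; Σ-syntax; uncurry; _×_; _,_; proj₁; proj₂)
open import Data.Rational.Base as ℚ using (ℚ; 0ℚ; 1ℚ; ↥_; ↧ₙ_; mkℚ)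
import Data.Rational.Properties as ℚ
import Data.Rational.Unnormalised.Base as ℚᵘ
import Data.Rational.Unnormalised.Properties as ℚᵘ
open import Data.Sum.Base using (_⊎_; inj₁; inj₂)
open import Relation.Binary.Bundles using (DecTotalOrder)
open import Relation.Binary.Consequences using (total∧dec⇒dec)
open import Relation.Binary.Definitions using (DecidableEquality; tri<; tri≈; tri>)
open import Relation.Binary.PropositionalEquality using (_≡_; _≢_; refl; sym; trans; cong; subst; subst₂; setoid)
open import Relation.Binary.Structures using (IsTotalOrder)
open import Relation.Nullary using (¬_; Dec; yes; no; does; ¬?; T?; _⊎-dec_)

module ℚLemmas where

  open import Data.Rational.Base using (_<_; _≤_; _*_; _+_)

  infixr 8 _^_
  _^_ : ℚ → ℕ → ℚ
  p ^ zero  = 1ℚ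
  p ^ suc k = p * p ^ k

  _×ℚ_ : ℕ → ℚ → ℚ
  zero  ×ℚ p = 0ℚ
  suc k ×ℚ p = p + k ×ℚ p

  abstract

    dense : ∀ p q → p < q → ∃[ m ] p < m × m < q
    dense p q = ℚ.<-dense {p} {q}

    0<1 : 0ℚ < 1ℚ
    0<1 = ℚ.positive⁻¹ 1ℚ

    *-pos : ∀ p q → 0ℚ < p → 0ℚ < q → 0ℚ < p * q
    *-pos p q 0<p 0<q =
      ℚ.positive⁻¹ (p * q) {{ℚ.pos*pos⇒pos p {{ℚ.positive 0<p}} q {{ℚ.positive 0<q}}}}

    +-pos : ∀ p q → 0ℚ < p → 0ℚ < q → 0ℚ < p + q
    +-pos p q 0<p 0<q = ℚ.+-mono-< {0ℚ} {p} {0ℚ} {q} 0<p 0<q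

    *-monoʳ-≤ : ∀ r p q → 0ℚ < r → p ≤ q → r * p ≤ r * q
    *-monoʳ-≤ r p q 0<r = ℚ.*-monoˡ-≤-nonNeg r {{ℚ.nonNegative (ℚ.<⇒≤ 0<r)}} {p} {q}

    *-monoˡ-≤ : ∀ r p q → 0ℚ < r → p ≤ q → p * r ≤ q * r
    *-monoˡ-≤ r p q 0<r = ℚ.*-monoʳ-≤-nonNeg r {{ℚ.nonNegative (ℚ.<⇒≤ 0<r)}} {p} {q}

    *-monoʳ-< : ∀ r p q → 0ℚ < r → p < q → r * p < r * q
    *-monoʳ-< r p q 0<r = ℚ.*-monoʳ-<-pos r {{ℚ.positive 0<r}} {p} {q}

    *-monoˡ-< : ∀ r p q → 0ℚ < r → p < q → p * r < q * r
    *-monoˡ-< r p q 0<r = ℚ.*-monoˡ-<-pos r {{ℚ.positive 0<r}} {p} {q}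

    +-mono-< : ∀ p q r s → p < q → r < s → p + r < q + s
    +-mono-< p q r s = ℚ.+-mono-< {p} {q} {r} {s}

    *-mono-< : ∀ p q r s → 0ℚ < p → p < q → 0ℚ < r → r < s → p * r < q * s
    *-mono-< p q r s 0<p p<q 0<r r<s =
      ℚ.<-trans {p * r} {q * r} {q * s} (*-monoˡ-< r p q 0<r p<q)
        (*-monoʳ-< q r s (ℚ.<-trans {0ℚ} {p} {q} 0<p p<q) r<s)

    *-cancelʳ-< : ∀ r p q → 0ℚ < r → p * r < q * r → p < q
    *-cancelʳ-< r p q 0<r = ℚ.*-cancelʳ-<-nonNeg r {{ℚ.nonNegative (ℚ.<⇒≤ 0<r)}} {p} {q}

    p<p+1 : ∀ p → p < p + 1ℚ
    p<p+1 p = subst (_< p + 1ℚ) (ℚ.+-identityʳ p) (ℚ.+-monoʳ-< p {0ℚ} {1ℚ} 0<1)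

    reciprocal : ∀ r → 0ℚ < r → ∃[ s ] 0ℚ < s × r * s ≡ 1ℚ
    reciprocal r 0<r = go (ℚ.positive 0<r)
      where
      go : ℚ.Positive r → ∃[ s ] 0ℚ < s × r * s ≡ 1ℚ
      go r⁺ = s , ℚ.positive⁻¹ s {{ℚ.1/pos⇒pos r {{r⁺}}}} , ℚ.*-inverseʳ r {{ℚ.pos⇒nonZero r {{r⁺}}}}
        where
        s : ℚ
        s = (ℚ.1/ r) {{ℚ.pos⇒nonZero r {{r⁺}}}}

    reciprocal-pos : ∀ r s → 0ℚ < r → r * s ≡ 1ℚ → 0ℚ < s
    reciprocal-pos r s 0<r rs≡1 = ℚ.*-cancelˡ-<-nonNeg r {{ℚ.nonNegative (ℚ.<⇒≤ 0<r)}} {0ℚ} {s}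
      (subst₂ _<_ (sym (ℚ.*-zeroʳ r)) (sym rs≡1) 0<1)

    reciprocal-anti : ∀ r s r′ s′ → 0ℚ < r → r * s ≡ 1ℚ → 0ℚ < r′ → r′ * s′ ≡ 1ℚ → s < s′ → r′ < r
    reciprocal-anti r s r′ s′ 0<r rs 0<r′ rs′ s<s′ = ℚ.≰⇒> λ r≤r′ →
      ℚ.<-irrefl refl (subst₂ _<_ rs rs′
        (ℚ.<-≤-trans {r * s} {r * s′} {r′ * s′} (*-monoʳ-< r s s′ 0<r s<s′)
                     (*-monoˡ-≤ s′ r r′ (reciprocal-pos r′ s′ 0<r′ rs′) r≤r′)))

    quotient : ∀ p q → 0ℚ < p → ∃[ c ] c * p ≡ q
    quotient p q 0<p = go (reciprocal p 0<p)
      where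
      go : (∃[ s ] 0ℚ < s × p * s ≡ 1ℚ) → ∃[ c ] c * p ≡ q
      go (s , _ , ps≡1) = q * s , trans (ℚ.*-assoc q s p)
        (trans (cong (q *_) {s * p} {1ℚ} (trans (ℚ.*-comm s p) ps≡1)) (ℚ.*-identityʳ q))

    sqrt-below : ∀ c → 1ℚ < c → ∃[ d ] 1ℚ < d × d * d ≤ c
    sqrt-below c 1<c = go (dense 1ℚ c 1<c)
      where
      go : (∃[ d ] 1ℚ < d × d < c) → ∃[ d ] 1ℚ < d × d * d ≤ c
      go (d , 1<d , d<c) = choose (d * d ℚ.≤? c) (quotient d c 0<d)
        where
        0<d : 0ℚ < d
        0<d = ℚ.<-trans {0ℚ} {1ℚ} {d} 0<1 1<d
        choose : Dec (d * d ≤ c) → (∃[ e ] e * d ≡ c) → ∃[ d ] 1ℚ < d × d * d ≤ c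
        choose (yes dd≤c) _           = d , 1<d , dd≤c
        choose (no  dd≰c) (e , ed≡c)  =
          e , 1<e , subst (e * e ≤_) ed≡c (*-monoʳ-≤ e e d (ℚ.<-trans {0ℚ} {1ℚ} {e} 0<1 1<e) (ℚ.<⇒≤ e<d))
          where
          1<e : 1ℚ < e
          1<e = *-cancelʳ-< d 1ℚ e 0<d (subst₂ _<_ (sym (ℚ.*-identityˡ d)) (sym ed≡c) d<c)
          e<d : e < d
          e<d = *-cancelʳ-< d e d 0<d (subst (_< d * d) (sym ed≡c) (ℚ.≰⇒> dd≰c))

    gap : ∀ p q → 0ℚ < p → p < q → ∃[ d ] 1ℚ < d × d * (d * p) < q
    gap p q 0<p p<q = go (dense p q p<q)
      where
      go : (∃[ m ] p < m × m < q) → ∃[ d ] 1ℚ < d × d * (d * p) < q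
      go (m , p<m , m<q) = go′ (quotient p m 0<p)
        where
        go′ : (∃[ c ] c * p ≡ m) → ∃[ d ] 1ℚ < d × d * (d * p) < q
        go′ (c , cp≡m) = go″ (sqrt-below c (*-cancelʳ-< p 1ℚ c 0<p
            (subst₂ _<_ (sym (ℚ.*-identityˡ p)) (sym cp≡m) p<m)))
          where
          go″ : (∃[ d ] 1ℚ < d × d * d ≤ c) → ∃[ d ] 1ℚ < d × d * (d * p) < q
          go″ (d , 1<d , dd≤c) = d , 1<d , ℚ.≤-<-trans {d * (d * p)} {m} {q}
            (subst₂ _≤_ (ℚ.*-assoc d d p) cp≡m (*-monoˡ-≤ p (d * d) c 0<p dd≤c)) m<q

    scale-up : ∀ d r → 1ℚ < d → 0ℚ < r → r < d * r
    scale-up d r 1<d 0<r = subst (_< d * r) (ℚ.*-identityˡ r) (*-monoˡ-< r 1ℚ d 0<r 1<d)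

    +-scale : ∀ c r s → 1ℚ < c → 0ℚ < r → 0ℚ < s → c * r + c * s ≤ c * (c * (r + s))
    +-scale c r s 1<c 0<r 0<s = subst (_≤ c * (c * (r + s))) (ℚ.*-distribˡ-+ c r s)
      (ℚ.<⇒≤ (scale-up c (c * (r + s)) 1<c
        (*-pos c (r + s) (ℚ.<-trans {0ℚ} {1ℚ} {c} 0<1 1<c) (+-pos r s 0<r 0<s))))

    *-scale : ∀ c r s → c * r * (c * s) ≤ c * (c * (r * s))
    *-scale c r s = ℚ.≤-reflexive {c * r * (c * s)} {c * (c * (r * s))}
      (trans (ℚ.*-assoc c r (c * s)) (cong (c *_) {r * (c * s)} {c * (r * s)}
        (trans (sym (ℚ.*-assoc r c s)) (trans (cong (_* s) {r * c} {c * r} (ℚ.*-comm r c)) (ℚ.*-assoc c r s)))))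

    ^-pos : ∀ p k → 0ℚ < p → 0ℚ < p ^ k
    ^-pos p zero    0<p = 0<1
    ^-pos p (suc k) 0<p = *-pos p (p ^ k) 0<p (^-pos p k 0<p)

    ^-mono-≤ : ∀ p q k → 0ℚ < p → p ≤ q → p ^ k ≤ q ^ k
    ^-mono-≤ p q zero    0<p p≤q = ℚ.≤-refl
    ^-mono-≤ p q (suc k) 0<p p≤q = ℚ.≤-trans {p * p ^ k} {q * p ^ k} {q * q ^ k}
      (*-monoˡ-≤ (p ^ k) p q (^-pos p k 0<p) p≤q)
      (*-monoʳ-≤ q (p ^ k) (q ^ k) (ℚ.<-≤-trans {0ℚ} {p} {q} 0<p p≤q) (^-mono-≤ p q k 0<p p≤q))

    ^-mono-< : ∀ p q k → 0ℚ < p → p < q → p ^ suc k < q ^ suc k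
    ^-mono-< p q k 0<p p<q = ℚ.<-≤-trans {p * p ^ k} {q * p ^ k} {q * q ^ k}
      (*-monoˡ-< (p ^ k) p q (^-pos p k 0<p) p<q)
      (*-monoʳ-≤ q (p ^ k) (q ^ k) (ℚ.<-trans {0ℚ} {p} {q} 0<p p<q) (^-mono-≤ p q k 0<p (ℚ.<⇒≤ p<q)))

    ^≤1 : ∀ p k → 0ℚ < p → p ≤ 1ℚ → p ^ k ≤ 1ℚ
    ^-below : ∀ p k → 0ℚ < p → p ≤ 1ℚ → p ^ suc k ≤ p
    ^≤1 p zero    0<p p≤1 = ℚ.≤-refl
    ^≤1 p (suc k) 0<p p≤1 = ℚ.≤-trans {p ^ suc k} {p} {1ℚ} (^-below p k 0<p p≤1) p≤1
    ^-below p k 0<p p≤1 =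
      subst (p * p ^ k ≤_) (ℚ.*-identityʳ p) (*-monoʳ-≤ p (p ^ k) 1ℚ 0<p (^≤1 p k 0<p p≤1))

    1≤^ : ∀ p k → 1ℚ ≤ p → 1ℚ ≤ p ^ k
    ^-above : ∀ p k → 1ℚ ≤ p → p ≤ p ^ suc k
    1≤^ p zero    1≤p = ℚ.≤-refl
    1≤^ p (suc k) 1≤p = ℚ.≤-trans {1ℚ} {p} {p ^ suc k} 1≤p (^-above p k 1≤p)
    ^-above p k 1≤p = subst (_≤ p * p ^ k) (ℚ.*-identityʳ p)
      (*-monoʳ-≤ p 1ℚ (p ^ k) (ℚ.<-≤-trans {0ℚ} {1ℚ} {p} 0<1 1≤p) (1≤^ p k 1≤p))

    ×ℚ-* : ∀ k p q → k ×ℚ p * q ≡ k ×ℚ (p * q)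
    ×ℚ-* zero    p q = ℚ.*-zeroˡ q
    ×ℚ-* (suc k) p q = trans (ℚ.*-distribʳ-+ q p (k ×ℚ p)) (cong (λ z → p * q + z) {k ×ℚ p * q} (×ℚ-* k p q))

    toℚᵘ-×1 : ∀ k → ℚ.toℚᵘ (k ×ℚ 1ℚ) ℚᵘ.≃ ℚᵘ.mkℚᵘ (+ k) 0
    toℚᵘ-×1 zero    = ℚᵘ.*≡* refl
    toℚᵘ-×1 (suc k) = ℚᵘ.≃-trans (ℚ.toℚᵘ-homo-+ 1ℚ (k ×ℚ 1ℚ))
      (ℚᵘ.≃-trans (ℚᵘ.+-congʳ ℚᵘ.1ℚᵘ (toℚᵘ-×1 k))
        (ℚᵘ.≃-reflexive (cong (λ i → ℚᵘ.mkℚᵘ (+ 1 ℤ.+ i) 0) (ℤ.*-identityʳ (+ k)))))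

    ≤-numerator : ∀ p → p ≤ ℤ.∣ ↥ p ∣ ×ℚ 1ℚ
    ≤-numerator p@(mkℚ (+ n) d _) = ℚ.toℚᵘ-cancel-≤ (ℚᵘ.≤-respʳ-≃ (ℚᵘ.≃-sym (toℚᵘ-×1 n))
      (ℚᵘ.*≤* (ℤ.*-monoˡ-≤-nonNeg (+ n) (ℤ.+≤+ (ℕ.s≤s ℕ.z≤n)))))
    ≤-numerator p@(mkℚ -[1+ n ] d _) =
      ℚ.toℚᵘ-cancel-≤ (ℚᵘ.≤-respʳ-≃ (ℚᵘ.≃-sym (toℚᵘ-×1 (suc n))) (ℚᵘ.*≤* ℤ.-≤+))

    archimedean : ∀ u ε → 0ℚ < ε → ∃[ k ] u ≤ k ×ℚ ε
    archimedean u ε 0<ε = go (quotient ε u 0<ε)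
      where
      go : (∃[ w ] w * ε ≡ u) → ∃[ k ] u ≤ k ×ℚ ε
      go (w , wε≡u) = ℤ.∣ ↥ w ∣ , subst₂ _≤_ wε≡u
        (trans (×ℚ-* ℤ.∣ ↥ w ∣ 1ℚ ε) (cong (ℤ.∣ ↥ w ∣ ×ℚ_) {1ℚ * ε} {ε} (ℚ.*-identityˡ ε)))
        (*-monoˡ-≤ ε w (ℤ.∣ ↥ w ∣ ×ℚ 1ℚ) 0<ε (≤-numerator w))

    p≤q+p : ∀ p q → 0ℚ < q → p ≤ q + p
    p≤q+p p q 0<q = subst (_≤ q + p) (ℚ.+-identityˡ p) (ℚ.+-monoˡ-≤ p {0ℚ} {q} (ℚ.<⇒≤ 0<q))

    split : ∀ p q → p + (q ℚ.- p) ≡ q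
    split p q = trans (ℚ.+-comm p (q ℚ.- p)) (trans (ℚ.+-assoc q (ℚ.- p) p)
      (trans (cong (λ z → q + z) {ℚ.- p + p} {0ℚ} (ℚ.+-inverseˡ p)) (ℚ.+-identityʳ q)))

    difference : ∀ p q → p < q → ∃[ e ] 0ℚ < e × p + e ≡ q
    difference p q p<q = q ℚ.- p
      , subst (_< q ℚ.- p) (ℚ.+-inverseʳ p) (ℚ.+-monoˡ-< (ℚ.- p) {p} {q} p<q) , split p q

    excess : ∀ d → 1ℚ < d → ∃[ e ] 0ℚ < e × (∀ l r → l ≤ r → r + e * l ≤ d * r)
    excess d 1<d = go (difference 1ℚ d 1<d)
      where
      go : (∃[ e ] 0ℚ < e × 1ℚ + e ≡ d) → ∃[ e ] 0ℚ < e × (∀ l r → l ≤ r → r + e * l ≤ d * r)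
      go (e , 0<e , 1+e≡d) = e , 0<e , λ l r l≤r → subst (r + e * l ≤_)
        (trans (cong (_+ e * r) {r} {1ℚ * r} (sym (ℚ.*-identityˡ r)))
          (trans (sym (ℚ.*-distribʳ-+ r 1ℚ e)) (cong (_* r) {1ℚ + e} {d} 1+e≡d)))
        (ℚ.+-monoʳ-≤ r {e * l} {e * r} (*-monoʳ-≤ e l r 0<e l≤r))

-- Positive real numbers, as Dedekind cuts in the positive rationals:
-- L q means 0 < q < x, and U q means x < q.
record ℝ₊ : Set₁ where
  field
    L U         : ℚ → Set
    L-pos       : ∀ {q} → L q → 0ℚ ℚ.< q
    L-inhabited : ∃ L
    U-inhabited : ∃ U
    L-closed    : ∀ {p q} → 0ℚ ℚ.< p → p ℚ.< q → L q → L p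
    U-closed    : ∀ {p q} → p ℚ.< q → U p → U q
    L-open      : ∀ {p} → L p → ∃[ q ] p ℚ.< q × L q
    U-open      : ∀ {q} → U q → ∃[ p ] p ℚ.< q × U p
    disjoint    : ∀ {q} → L q → ¬ U q
    located     : ∀ {p q} → 0ℚ ℚ.< p → p ℚ.< q → L p ⊎ U q

module ℝ₊Lemmas (x : ℝ₊) where

  open ℝ₊ x
  open ℚLemmas
  open import Data.Rational.Base using (_<_; _≤_; _*_; _+_)

  abstract

    L<U : ∀ {p q} → L p → U q → p < q
    L<U {p} {q} Lp Uq with ℚ.<-cmp p q
    ... | tri< p<q _ _  = p<q
    ... | tri≈ _ refl _ = ⊥-elim (disjoint Lp Uq)
    ... | tri> _ _ q<p  = ⊥-elim (disjoint Lp (U-closed q<p Uq))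

    U-pos : ∀ {q} → U q → 0ℚ < q
    U-pos {q} Uq = go L-inhabited
      where
      go : ∃ L → 0ℚ < q
      go (l , Ll) = ℚ.<-trans {0ℚ} {l} {q} (L-pos Ll) (L<U Ll Uq)

    L-closed-≤ : ∀ {p q} → 0ℚ < p → p ≤ q → L q → L p
    L-closed-≤ {p} {q} 0<p p≤q Lq with ℚ.<-cmp p q
    ... | tri< p<q _ _  = L-closed 0<p p<q Lq
    ... | tri≈ _ refl _ = Lq
    ... | tri> _ _ q<p  = ⊥-elim (ℚ.<-irrefl refl (ℚ.<-≤-trans q<p p≤q))

    U-closed-≤ : ∀ {p q} → p ≤ q → U p → U q
    U-closed-≤ {p} {q} p≤q Up with ℚ.<-cmp p q
    ... | tri< p<q _ _  = U-closed p<q Up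
    ... | tri≈ _ refl _ = Up
    ... | tri> _ _ q<p  = ⊥-elim (ℚ.<-irrefl refl (ℚ.<-≤-trans q<p p≤q))

    -- Walk up from a lower bound in steps of ratio d, where d * d ≤ c, until
    -- an upper bound is met.
    approximate : ∀ c → 1ℚ < c → ∃[ r ] L r × U (c * r)
    approximate c 1<c = go (sqrt-below c 1<c) L-inhabited U-inhabited
      where
      go : (∃[ d ] 1ℚ < d × d * d ≤ c) → ∃ L → ∃ U → ∃[ r ] L r × U (c * r)
      go (d , 1<d , dd≤c) (l , Ll) (u , Uu) = start (excess d 1<d)
        where
        0<d : 0ℚ < d
        0<d = ℚ.<-trans {0ℚ} {1ℚ} {d} 0<1 1<d

        walk : ∀ ε → (∀ r → l ≤ r → r + ε ≤ d * r) →
               ∀ k r → l ≤ r → L r → u ≤ r + k ×ℚ ε → ∃[ r ] L r × U (c * r)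
        walk ε grow zero r l≤r Lr u≤ = ⊥-elim (ℚ.<-irrefl {r} refl
          (ℚ.<-≤-trans {r} {u} {r} (L<U Lr Uu) (subst (u ≤_) (ℚ.+-identityʳ r) u≤)))
        walk ε grow (suc k) r l≤r Lr u≤ =
          step (located 0<dr (scale-up d (d * r) 1<d 0<dr))
          where
          0<dr : 0ℚ < d * r
          0<dr = *-pos d r 0<d (L-pos Lr)
          step : L (d * r) ⊎ U (d * (d * r)) → ∃[ r ] L r × U (c * r)
          step (inj₁ Ldr)  = walk ε grow k (d * r)
            (ℚ.≤-trans {l} {r} {d * r} l≤r (ℚ.<⇒≤ (scale-up d r 1<d (L-pos Lr)))) Ldr
            (ℚ.≤-trans {u} {r + (ε + k ×ℚ ε)} {d * r + k ×ℚ ε} u≤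
              (subst (_≤ d * r + k ×ℚ ε) (ℚ.+-assoc r ε (k ×ℚ ε))
                (ℚ.+-monoˡ-≤ (k ×ℚ ε) {r + ε} {d * r} (grow r l≤r))))
          step (inj₂ Uddr) = r , Lr , U-closed-≤
            (subst (_≤ c * r) (ℚ.*-assoc d d r) (*-monoˡ-≤ r (d * d) c (L-pos Lr) dd≤c)) Uddr

        start : (∃[ e ] 0ℚ < e × (∀ l r → l ≤ r → r + e * l ≤ d * r)) → ∃[ r ] L r × U (c * r)
        start (e , 0<e , grow) = finish (archimedean u (e * l) (*-pos e l 0<e (L-pos Ll)))
          where
          finish : (∃[ k ] u ≤ k ×ℚ (e * l)) → ∃[ r ] L r × U (c * r)
          finish (k , u≤kε) = walk (e * l) (grow l) k l ℚ.≤-refl Ll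
            (ℚ.≤-trans {u} {k ×ℚ (e * l)} {l + k ×ℚ (e * l)} u≤kε (p≤q+p (k ×ℚ (e * l)) l (L-pos Ll)))

infix 4 _<ᵣ_ _≤ᵣ_

_<ᵣ_ _≤ᵣ_ : ℝ₊ → ℝ₊ → Set
x <ᵣ y = ∃[ q ] ℝ₊.U x q × ℝ₊.L y q
x ≤ᵣ y = ∀ q → ℝ₊.L x q → ℝ₊.L y q

-- The real determined by positive rationals r ≤ x (Lower) and x ≤ r (Upper).
-- Neither predicate has to be rounded or closed: taking 0 < q < r with Lower r
-- and r < q with Upper r yields an honest cut.
module Cut
  (Lower Upper : ℚ → Set)
  (lower       : ∃[ r ] 0ℚ ℚ.< r × Lower r)
  (upper       : ∃[ r ] 0ℚ ℚ.< r × Upper r)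
  (separate    : ∀ {r s} → 0ℚ ℚ.< r → 0ℚ ℚ.< s → Lower r → Upper s → ¬ s ℚ.< r)
  (locate      : ∀ {r s} → 0ℚ ℚ.< r → r ℚ.< s → Lower r ⊎ Upper s)
  where

  open ℚLemmas
  open import Data.Rational.Base using (_<_; _≤_; _*_; _+_)

  private
    L U : ℚ → Set
    L q = 0ℚ < q × (∃[ r ] q < r × Lower r)
    U q = ∃[ r ] 0ℚ < r × r < q × Upper r

  cut : ℝ₊
  cut = record
    { L           = L
    ; U           = U
    ; L-pos       = proj₁
    ; L-inhabited = l-inh lower
    ; U-inhabited = u-inh upper
    ; L-closed    = λ {p} {q} 0<p p<q (_ , r , q<r , Lr) → 0<p , r , ℚ.<-trans {p} {q} {r} p<q q<r , Lr
    ; U-closed    = λ {p} {q} p<q (r , 0<r , r<p , Ur) → r , 0<r , ℚ.<-trans {r} {p} {q} r<p p<q , Ur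
    ; L-open      = l-open
    ; U-open      = u-open
    ; disjoint    = λ {q} (0<q , r , q<r , Lr) (s , 0<s , s<q , Us) →
                    separate (ℚ.<-trans {0ℚ} {q} {r} 0<q q<r) 0<s Lr Us (ℚ.<-trans {s} {q} {r} s<q q<r)
    ; located     = loc
    }
    where
    l-inh : (∃[ r ] 0ℚ < r × Lower r) → ∃ L
    l-inh (r , 0<r , Lr) = let q , 0<q , q<r = dense 0ℚ r 0<r in q , 0<q , r , q<r , Lr
    u-inh : (∃[ r ] 0ℚ < r × Upper r) → ∃ U
    u-inh (r , 0<r , Ur) = r + 1ℚ , r , 0<r , p<p+1 r , Ur
    l-open : ∀ {p} → L p → ∃[ q ] p < q × L q
    l-open {p} (0<p , r , p<r , Lr) = let q , p<q , q<r = dense p r p<r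
      in q , p<q , ℚ.<-trans {0ℚ} {p} {q} 0<p p<q , r , q<r , Lr
    u-open : ∀ {q} → U q → ∃[ p ] p < q × U p
    u-open {q} (r , 0<r , r<q , Ur) = let p , r<p , p<q = dense r q r<q
      in p , p<q , r , 0<r , r<p , Ur
    loc : ∀ {p q} → 0ℚ < p → p < q → L p ⊎ U q
    loc {p} {q} 0<p p<q with dense p q p<q
    ... | m , p<m , m<q with dense m q m<q
    ...   | m′ , m<m′ , m′<q with locate (ℚ.<-trans {0ℚ} {p} {m} 0<p p<m) m<m′
    ...     | inj₁ Lm  = inj₁ (0<p , m , p<m , Lm)
    ...     | inj₂ Um′ = inj₂ (m′ , ℚ.<-trans {0ℚ} {m} {m′} (ℚ.<-trans {0ℚ} {p} {m} 0<p p<m) m<m′ , m′<q , Um′)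

fromℚ₊ : (c : ℚ) → 0ℚ ℚ.< c → ℝ₊
fromℚ₊ c 0<c = Cut.cut (ℚ._≤ c) (c ℚ.≤_) (c , 0<c , ℚ.≤-refl) (c , 0<c , ℚ.≤-refl)
  (λ _ _ r≤c c≤s s<r → ℚ.<-irrefl refl (ℚ.<-≤-trans s<r (ℚ.≤-trans r≤c c≤s)))
  locate
  where
  locate : ∀ {r s} → 0ℚ ℚ.< r → r ℚ.< s → r ℚ.≤ c ⊎ c ℚ.≤ s
  locate {r} {s} _ r<s with ℚ.≤-total r c
  ... | inj₁ r≤c = inj₁ r≤c
  ... | inj₂ c≤r = inj₂ (ℚ.≤-trans c≤r (ℚ.<⇒≤ r<s))

fromℕ : (k : ℕ) .{{_ : ℕ.NonZero k}} → ℝ₊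
fromℕ k@(suc _) = fromℚ₊ (+ k ℚ./ 1) (ℚ.positive⁻¹ _ {{ℚ.normalize-pos k 1}})

-- The continuous extension to ℝ₊ of a strictly increasing operation on
-- positive rationals; scale supplies the continuity needed for locatedness.
module Extend
  (_∙_   : ℚ → ℚ → ℚ)
  (pos   : ∀ p q → 0ℚ ℚ.< p → 0ℚ ℚ.< q → 0ℚ ℚ.< p ∙ q)
  (mono  : ∀ p q r s → 0ℚ ℚ.< p → p ℚ.< q → 0ℚ ℚ.< r → r ℚ.< s → (p ∙ r) ℚ.< (q ∙ s))
  (scale : ∀ c r s → 1ℚ ℚ.< c → 0ℚ ℚ.< r → 0ℚ ℚ.< s →
           ((c ℚ.* r) ∙ (c ℚ.* s)) ℚ.≤ (c ℚ.* (c ℚ.* (r ∙ s))))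
  where

  open ℚLemmas
  open import Data.Rational.Base using (_<_; _≤_; _*_)

  extend : ℝ₊ → ℝ₊ → ℝ₊
  extend x y = Cut.cut Lower Upper (lower X.L-inhabited Y.L-inhabited) (upper X.U-inhabited Y.U-inhabited)
    separate locate
    where
    module X where
      open ℝ₊ x public
      open ℝ₊Lemmas x public
    module Y where
      open ℝ₊ y public
      open ℝ₊Lemmas y public
    Lower Upper : ℚ → Set
    Lower p = ∃[ r ] ∃[ s ] X.L r × Y.L s × p ≤ (r ∙ s)
    Upper p = ∃[ r ] ∃[ s ] X.U r × Y.U s × (r ∙ s) ≤ p
    lower : ∃ X.L → ∃ Y.L → ∃[ p ] 0ℚ < p × Lower p
    lower (r , Lr) (s , Ls) = (r ∙ s) , pos r s (X.L-pos Lr) (Y.L-pos Ls) , r , s , Lr , Ls , ℚ.≤-refl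
    upper : ∃ X.U → ∃ Y.U → ∃[ p ] 0ℚ < p × Upper p
    upper (r , Ur) (s , Us) = (r ∙ s) , pos r s (X.U-pos Ur) (Y.U-pos Us) , r , s , Ur , Us , ℚ.≤-refl
    separate : ∀ {p q} → 0ℚ < p → 0ℚ < q → Lower p → Upper q → ¬ q < p
    separate {p} {q} _ _ (r , s , Lr , Ls , p≤rs) (r′ , s′ , Ur′ , Us′ , r′s′≤q) q<p = ℚ.<-irrefl {q} refl
      (ℚ.<-trans {q} {p} {q} q<p (ℚ.≤-<-trans {p} {r ∙ s} {q} p≤rs
        (ℚ.<-≤-trans {r ∙ s} {r′ ∙ s′} {q}
          (mono r r′ s s′ (X.L-pos Lr) (X.L<U Lr Ur′) (Y.L-pos Ls) (Y.L<U Ls Us′)) r′s′≤q)))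
    locate : ∀ {p q} → 0ℚ < p → p < q → Lower p ⊎ Upper q
    locate {p} {q} 0<p p<q = go (gap p q 0<p p<q)
      where
      go : (∃[ d ] 1ℚ < d × d * (d * p) < q) → Lower p ⊎ Upper q
      go (d , 1<d , ddp<q) = compare (X.approximate d 1<d) (Y.approximate d 1<d)
        where
        0<d : 0ℚ < d
        0<d = ℚ.<-trans {0ℚ} {1ℚ} {d} 0<1 1<d
        compare : (∃[ r ] X.L r × X.U (d * r)) → (∃[ s ] Y.L s × Y.U (d * s)) → Lower p ⊎ Upper q
        compare (r , Lr , Udr) (s , Ls , Uds) with ℚ.≤-total p (r ∙ s)
        ... | inj₁ p≤rs = inj₁ (r , s , Lr , Ls , p≤rs)
        ... | inj₂ rs≤p = inj₂ (d * r , d * s , Udr , Uds ,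
          ℚ.≤-trans {(d * r) ∙ (d * s)} {d * (d * (r ∙ s))} {q} (scale d r s 1<d (X.L-pos Lr) (Y.L-pos Ls))
            (ℚ.≤-trans {d * (d * (r ∙ s))} {d * (d * p)} {q}
              (*-monoʳ-≤ d (d * (r ∙ s)) (d * p) 0<d (*-monoʳ-≤ d (r ∙ s) p 0<d rs≤p))
              (ℚ.<⇒≤ ddp<q)))

infixl 6 _+ᵣ_
infixl 7 _*ᵣ_ _/ᵣ_
infixr 8 _^ᵣ_ _^ℚ_
infixl 9 _⁻¹

_+ᵣ_ : ℝ₊ → ℝ₊ → ℝ₊
_+ᵣ_ = Extend.extend ℚ._+_ +-pos (λ p q r s _ p<q _ r<s → +-mono-< p q r s p<q r<s) +-scale
  where open ℚLemmas

_*ᵣ_ : ℝ₊ → ℝ₊ → ℝ₊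
_*ᵣ_ = Extend.extend ℚ._*_ *-pos *-mono-< (λ c r s _ _ _ → *-scale c r s)
  where open ℚLemmas

_⁻¹ : ℝ₊ → ℝ₊
x ⁻¹ = Cut.cut Lower Upper (lower U-inhabited) (upper L-inhabited) separate locate
  where
  open ℚLemmas
  open import Data.Rational.Base using (_<_; _*_)
  open ℝ₊ x
  open ℝ₊Lemmas x
  Lower Upper : ℚ → Set
  Lower r = ∃[ s ] U s × s * r ≡ 1ℚ
  Upper r = ∃[ s ] L s × s * r ≡ 1ℚ
  lower : ∃ U → ∃[ r ] 0ℚ < r × Lower r
  lower (s , Us) = let r , 0<r , sr≡1 = reciprocal s (U-pos Us) in r , 0<r , s , Us , sr≡1
  upper : ∃ L → ∃[ r ] 0ℚ < r × Upper r
  upper (s , Ls) = let r , 0<r , sr≡1 = reciprocal s (L-pos Ls) in r , 0<r , s , Ls , sr≡1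
  separate : ∀ {p q} → 0ℚ < p → 0ℚ < q → Lower p → Upper q → ¬ q < p
  separate {p} {q} _ _ (r , Ur , rp≡1) (s , Ls , sq≡1) q<p =
    ℚ.<-asym (L<U Ls Ur) (reciprocal-anti s q r p (L-pos Ls) sq≡1 (U-pos Ur) rp≡1 q<p)
  locate : ∀ {p q} → 0ℚ < p → p < q → Lower p ⊎ Upper q
  locate {p} {q} 0<p p<q = go (reciprocal p 0<p) (reciprocal q (ℚ.<-trans {0ℚ} {p} {q} 0<p p<q))
    where
    go : (∃[ r ] 0ℚ < r × p * r ≡ 1ℚ) → (∃[ s ] 0ℚ < s × q * s ≡ 1ℚ) → Lower p ⊎ Upper q
    go (r , 0<r , pr≡1) (s , 0<s , qs≡1)
      with located 0<s (reciprocal-anti r p s q 0<r rp≡1 0<s sq≡1 p<q)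
      where
      rp≡1 = trans (ℚ.*-comm r p) pr≡1
      sq≡1 = trans (ℚ.*-comm s q) qs≡1
    ... | inj₁ Ls = inj₂ (s , Ls , trans (ℚ.*-comm s q) qs≡1)
    ... | inj₂ Ur = inj₁ (r , Ur , trans (ℚ.*-comm r p) pr≡1)

_/ᵣ_ : ℝ₊ → ℝ₊ → ℝ₊
x /ᵣ y = x *ᵣ y ⁻¹

_^ᵣ_ : ℝ₊ → ℕ → ℝ₊
x ^ᵣ zero  = fromℕ 1
x ^ᵣ suc k = x *ᵣ x ^ᵣ k

root : (d : ℕ) .{{_ : ℕ.NonZero d}} → ℝ₊ → ℝ₊
root d@(suc k) x = Cut.cut Lower Upper (lower L-inhabited) (upper U-inhabited) separate locate
  where
  open ℚLemmas
  open import Data.Rational.Base using (_<_; _≤_)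
  open ℝ₊ x
  open ℝ₊Lemmas x
  Lower Upper : ℚ → Set
  Lower r = L (r ^ d)
  Upper r = U (r ^ d)
  lower : ∃ L → ∃[ r ] 0ℚ < r × Lower r
  lower (l , Ll) with ℚ.≤-total l 1ℚ
  ... | inj₁ l≤1 = l , L-pos Ll , L-closed-≤ (^-pos l d (L-pos Ll)) (^-below l k (L-pos Ll) l≤1) Ll
  ... | inj₂ 1≤l = 1ℚ , 0<1 , L-closed-≤ (^-pos 1ℚ d 0<1)
    (ℚ.≤-trans {1ℚ ^ d} {1ℚ} {l} (^-below 1ℚ k 0<1 ℚ.≤-refl) 1≤l) Ll
  upper : ∃ U → ∃[ r ] 0ℚ < r × Upper r
  upper (u , Uu) with ℚ.≤-total u 1ℚ
  ... | inj₁ u≤1 = 1ℚ , 0<1 , U-closed-≤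
    (ℚ.≤-trans {u} {1ℚ} {1ℚ ^ d} u≤1 (^-above 1ℚ k ℚ.≤-refl)) Uu
  ... | inj₂ 1≤u = u , U-pos Uu , U-closed-≤ (^-above u k 1≤u) Uu
  separate : ∀ {p q} → 0ℚ < p → 0ℚ < q → Lower p → Upper q → ¬ q < p
  separate {p} {q} _ 0<q Lp Uq q<p = ℚ.<-asym (L<U Lp Uq) (^-mono-< q p k 0<q q<p)
  locate : ∀ {p q} → 0ℚ < p → p < q → Lower p ⊎ Upper q
  locate {p} {q} 0<p p<q = located (^-pos p d 0<p) (^-mono-< p q k 0<p p<q)

-- x ^ (k / d) is the d-th root of x ^ k, for k / d in lowest terms.
_^ℚ_ : ℝ₊ → ℚ → ℝ₊
x ^ℚ q with ↥ q
... | + k      = root (↧ₙ q) (x ^ᵣ k)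
... | -[1+ k ] = root (↧ₙ q) (x ^ᵣ suc k) ⁻¹

log₂ : (n : ℕ) → 2 ℕ.≤ n → ℝ₊
log₂ n 2≤n = Cut.cut Lower Upper lower upper separate′ locate
  where
  open ℚLemmas using (0<1)
  open import Data.Rational.Base using (_<_; _≤_)
  -- for r = a/b > 0: r ≤ log₂ n iff 2ᵃ ≤ nᵇ
  Lower Upper : ℚ → Set
  Lower r = 2 ℕ.^ ℤ.∣ ↥ r ∣ ℕ.≤ n ℕ.^ ↧ₙ r
  Upper r = n ℕ.^ ↧ₙ r ℕ.≤ 2 ℕ.^ ℤ.∣ ↥ r ∣
  lower : ∃[ r ] 0ℚ < r × Lower r
  lower = 1ℚ , 0<1 , subst (2 ℕ.≤_) (sym (ℕ.*-identityʳ n)) 2≤n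
  n≤2^ : ∀ n → n ℕ.≤ 2 ℕ.^ n
  n≤2^ zero    = ℕ.z≤n
  n≤2^ (suc n) = ℕ.+-mono-≤ (ℕ.m^n>0 2 n) (ℕ.≤-trans (n≤2^ n) (ℕ.m≤m+n (2 ℕ.^ n) 0))
  upper : ∃[ r ] 0ℚ < r × Upper r
  upper = mkℚ (+ n) 0 (Coprime.sym (Coprime.1-coprimeTo n))
    , ℚ.positive⁻¹ _ {{n>0 n (Coprime.sym (Coprime.1-coprimeTo n)) 2≤n}}
    , ℕ.≤-trans (ℕ.≤-reflexive (ℕ.*-identityʳ n)) (n≤2^ n)
    where
    n>0 : ∀ n .(c : Coprime.Coprime n 1) → 2 ℕ.≤ n → ℚ.Positive (mkℚ (+ n) 0 c)
    n>0 _ _ (ℕ.s≤s _) = _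
  cross : ∀ a b a′ b′ → 2 ℕ.^ a ℕ.≤ n ℕ.^ b → n ℕ.^ b′ ℕ.≤ 2 ℕ.^ a′ → ¬ a′ ℕ.* b ℕ.< a ℕ.* b′
  cross a b a′ b′ 2ᵃ≤nᵇ nᵇ′≤2ᵃ′ a′b<ab′ = ℕ.<-irrefl refl (begin-strict
    2 ℕ.^ (a′ ℕ.* b)   <⟨ ℕ.^-monoʳ-< 2 (ℕ.s≤s (ℕ.s≤s ℕ.z≤n)) a′b<ab′ ⟩
    2 ℕ.^ (a ℕ.* b′)   ≡⟨ ℕ.^-*-assoc 2 a b′ ⟨
    (2 ℕ.^ a) ℕ.^ b′   ≤⟨ ℕ.^-monoˡ-≤ b′ 2ᵃ≤nᵇ ⟩
    (n ℕ.^ b) ℕ.^ b′   ≡⟨ ℕ.^-*-assoc n b b′ ⟩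
    n ℕ.^ (b ℕ.* b′)   ≡⟨ cong (n ℕ.^_) (ℕ.*-comm b b′) ⟩
    n ℕ.^ (b′ ℕ.* b)   ≡⟨ ℕ.^-*-assoc n b′ b ⟨
    (n ℕ.^ b′) ℕ.^ b   ≤⟨ ℕ.^-monoˡ-≤ b nᵇ′≤2ᵃ′ ⟩
    (2 ℕ.^ a′) ℕ.^ b   ≡⟨ ℕ.^-*-assoc 2 a′ b ⟩
    2 ℕ.^ (a′ ℕ.* b)   ∎)
    where open ℕ.≤-Reasoning
  separate : ∀ p q → 0ℚ < p → 0ℚ < q → Lower p → Upper q → ¬ q < p
  separate (mkℚ -[1+ _ ] _ _) _                  (ℚ.*<* ()) _ _  _  _
  separate (mkℚ (+ _) _ _)    (mkℚ -[1+ _ ] _ _) _ (ℚ.*<* ()) _  _  _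
  separate (mkℚ (+ a) b _)    (mkℚ (+ a′) b′ _)  _ _  Lp Uq (ℚ.*<* q<p) =
    cross a (suc b) a′ (suc b′) Lp Uq
      (ℤ.drop‿+<+ (subst₂ ℤ._<_ (sym (ℤ.pos-* a′ (suc b))) (sym (ℤ.pos-* a (suc b′))) q<p))
  separate′ : ∀ {p q} → 0ℚ < p → 0ℚ < q → Lower p → Upper q → ¬ q < p
  separate′ {p} {q} = separate p q
  locate : ∀ {p q} → 0ℚ < p → p < q → Lower p ⊎ Upper q
  locate {p} {q} 0<p p<q with 2 ℕ.^ ℤ.∣ ↥ p ∣ ℕ.≤? n ℕ.^ ↧ₙ p | n ℕ.^ ↧ₙ q ℕ.≤? 2 ℕ.^ ℤ.∣ ↥ q ∣
  ... | yes Lp | _      = inj₁ Lp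
  ... | no  _  | yes Uq = inj₂ Uq
  ... | no ¬Lp | no ¬Uq = ⊥-elim (separate q p (ℚ.<-trans {0ℚ} {p} {q} 0<p p<q) 0<p
                            (ℕ.≰⇒≥ ¬Uq) (ℕ.≰⇒≥ ¬Lp) p<q)

record Graph (n : ℕ) : Set where
  field
    adjacent  : Fin n → Fin n → Bool
    symmetric : ∀ u v → adjacent u v ≡ adjacent v u
    loopless  : ∀ v → adjacent v v ≡ false

-- An unordered pair {lo , hi} of adjacent vertices; the two proofs are
-- irrelevant, so edges with the same ends are equal.
record Edge {n : ℕ} (G : Graph n) : Set where
  constructor edge
  field
    lo hi   : Fin n
    .lo<hi  : lo Fin.< hi
    .joined : T (Graph.adjacent G lo hi)

module _ {n : ℕ} {G : Graph n} where

  open Edge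

  infix 4 _∈ᴱ_ _∈ᴱ?_ _≟ᴱ_

  _∈ᴱ_ : Fin n → Edge G → Set
  v ∈ᴱ e = v ≡ lo e ⊎ v ≡ hi e

  _∈ᴱ?_ : ∀ v e → Dec (v ∈ᴱ e)
  v ∈ᴱ? e = (v Fin.≟ lo e) ⊎-dec (v Fin.≟ hi e)

  _≟ᴱ_ : DecidableEquality (Edge G)
  edge u v _ _ ≟ᴱ edge u′ v′ _ _ with u Fin.≟ u′ | v Fin.≟ v′
  ... | yes refl | yes refl = yes refl
  ... | yes _    | no  v≢v′ = no λ { refl → v≢v′ refl }
  ... | no  u≢u′ | _        = no λ { refl → u≢u′ refl }

  edgesBetween : Fin n → Fin n → List (Edge G)
  edgesBetween u v with u Fin.<? v | T? (Graph.adjacent G u v)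
  ... | yes u<v | yes uv = edge u v u<v uv ∷ []
  ... | _       | _      = []

module _ {n : ℕ} (G : Graph n) where

  allEdges : List (Edge G)
  allEdges = concatMap (λ u → concatMap (edgesBetween u) (allFin n)) (allFin n)

  ∈-allEdges : ∀ e → e ∈ allEdges
  ∈-allEdges e@(edge u v u<v uv) =
    ∈-concatMap⁺ (λ u → concatMap (edgesBetween u) (allFin n)) (lose (∈-allFin u)
      (∈-concatMap⁺ (edgesBetween u) (lose (∈-allFin v) here′)))
    where
    here′ : e ∈ edgesBetween u v
    here′ with u Fin.<? v | T? (Graph.adjacent G u v)
    ... | yes _   | yes _  = here refl
    ... | yes _   | no ¬uv = ⊥-elim-irr (¬uv uv)
    ... | no ¬u<v | _      = ⊥-elim-irr (¬u<v u<v)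

record OrderedGraph (n : ℕ) : Set₁ where
  field
    graph          : Graph n
    _≤E_           : Edge graph → Edge graph → Set
    _≤V_           : Fin n → Fin n → Set
    ≤E-isTotalOrder : IsTotalOrder _≡_ _≤E_
    ≤V-isTotalOrder : IsTotalOrder _≡_ _≤V_

  V E : Set
  V = Fin n
  E = Edge graph

private
  decTotalOrder : ∀ {A : Set} {_≤_ : A → A → Set} →
                  DecidableEquality A → IsTotalOrder _≡_ _≤_ → DecTotalOrder _ _ _
  decTotalOrder _≟_ isTotalOrder = record
    { isDecTotalOrder = record
      { isTotalOrder = isTotalOrder
      ; _≟_          = _≟_
      ; _≤?_         = total∧dec⇒dec reflexive antisym total _≟_
      }
    }
    where open IsTotalOrder isTotalOrder

module HeightTable {n : ℕ} (G : OrderedGraph n) where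

  open OrderedGraph G

  private
    module SortE = Sort (decTotalOrder _≟ᴱ_ ≤E-isTotalOrder)
    module SortV = Sort (decTotalOrder Fin._≟_ ≤V-isTotalOrder)

  edges : List E
  edges = SortE.sort (allEdges graph)

  vertices : List V
  vertices = SortV.sort (allFin n)

  -- Lists of edges not yet entered are kept in ≤E-increasing order.
  largestAt : List E → V → Maybe E
  largestAt R v = last (filter (v ∈ᴱ?_) R)

  enter : List E → V → List E
  enter R v = maybe′ (λ e → filter (λ f → ¬? (f ≟ᴱ e)) R) R (largestAt R v)

  rowEntry : List E → List V → V → Maybe E
  rowEntry R []       v = nothing
  rowEntry R (w ∷ ws) v = if does (v Fin.≟ w) then largestAt R v else rowEntry (enter R w) ws v

  -- The edges not entered in the first i rows.
  left : ℕ → List E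
  left zero    = edges
  left (suc i) = foldl enter (left i) vertices

  -- The entry in column v of the (i + 1)-st row.
  HT : ℕ → V → Maybe E
  HT i v = rowEntry (left i) vertices v

  private
    last-nothing : ∀ {xs : List E} → last xs ≡ nothing → xs ≡ []
    last-nothing {[]}         _  = refl
    last-nothing {_ ∷ y ∷ xs} eq with () ← last-nothing {y ∷ xs} eq

    last-∈ : ∀ {xs : List E} {e} → last xs ≡ just e → e ∈ xs
    last-∈ {_ ∷ []}     refl = here refl
    last-∈ {_ ∷ y ∷ xs} eq   = there (last-∈ {y ∷ xs} eq)

    enter-⊆ : ∀ R v {f} → f ∈ enter R v → f ∈ R
    enter-⊆ R v f∈ with largestAt R v
    ... | nothing = f∈
    ... | just e  = proj₁ (∈-filter⁻ (λ f → ¬? (f ≟ᴱ e)) f∈)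

    enter-length : ∀ R v → length (enter R v) ℕ.≤ length R
    enter-length R v with largestAt R v
    ... | nothing = ℕ.≤-refl
    ... | just e  = length-filter (λ f → ¬? (f ≟ᴱ e)) R

    foldl-length : ∀ R vs → length (foldl enter R vs) ℕ.≤ length R
    foldl-length R []       = ℕ.≤-refl
    foldl-length R (v ∷ vs) = ℕ.≤-trans (foldl-length (enter R v) vs) (enter-length R v)

    foldl-⊆ : ∀ R vs {f} → f ∈ foldl enter R vs → f ∈ R
    foldl-⊆ R []       f∈ = f∈
    foldl-⊆ R (v ∷ vs) f∈ = enter-⊆ R v (foldl-⊆ (enter R v) vs f∈)

    largestAt-∈ : ∀ R v {e} → largestAt R v ≡ just e → e ∈ R
    largestAt-∈ R v eq = proj₁ (∈-filter⁻ (v ∈ᴱ?_) (last-∈ eq))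

    rowEntry-here : ∀ R w ws → rowEntry R (w ∷ ws) w ≡ largestAt R w
    rowEntry-here R w ws with w Fin.≟ w
    ... | yes _  = refl
    ... | no w≢w = ⊥-elim (w≢w refl)

    rowEntry-there : ∀ R {w} ws {v} → w ≢ v → rowEntry R (w ∷ ws) v ≡ rowEntry (enter R w) ws v
    rowEntry-there R {w} ws {v} w≢v with v Fin.≟ w
    ... | yes v≡w = ⊥-elim (w≢v (sym v≡w))
    ... | no  _   = refl

    entered-in-row : ∀ R vs → Unique vs → ∀ {e} → e ∈ R →
      e ∈ foldl enter R vs ⊎ (∃[ v ] v ∈ vs × rowEntry R vs v ≡ just e)
    entered-in-row R [] _ e∈R = inj₁ e∈R
    entered-in-row R (w ∷ ws) (w∉ ∷ uws) {e} e∈R = split (enter-∈ (largestAt R w) refl)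
      where
      enter-∈ : ∀ m → largestAt R w ≡ m → e ∈ enter R w ⊎ largestAt R w ≡ just e
      enter-∈ nothing  eq = inj₁ (subst (λ m → e ∈ maybe′ _ R m) (sym eq) e∈R)
      enter-∈ (just f) eq with e ≟ᴱ f
      ... | yes refl = inj₂ eq
      ... | no  e≢f  = inj₁ (subst (λ m → e ∈ maybe′ _ R m) (sym eq)
                                   (∈-filter⁺ (λ g → ¬? (g ≟ᴱ f)) e∈R e≢f))
      split : e ∈ enter R w ⊎ largestAt R w ≡ just e →
              e ∈ foldl enter R (w ∷ ws) ⊎ (∃[ v ] v ∈ w ∷ ws × rowEntry R (w ∷ ws) v ≡ just e)
      split (inj₂ eq)  = inj₂ (w , here refl , trans (rowEntry-here R w ws) eq)
      split (inj₁ e∈′) with entered-in-row (enter R w) ws uws e∈′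
      ... | inj₁ e∈″             = inj₁ e∈″
      ... | inj₂ (v , v∈ws , eq) =
        inj₂ (v , there v∈ws , trans (rowEntry-there R ws (All.lookup w∉ v∈ws)) eq)

    row-shrinks : ∀ R vs {e v} → e ∈ R → v ∈ᴱ e → v ∈ vs → length (foldl enter R vs) ℕ.< length R
    row-shrinks R (w ∷ ws) {e} {v} e∈R v∈e v∈vs = go (largestAt R w) refl v∈vs
      where
      go : ∀ m → largestAt R w ≡ m → v ∈ w ∷ ws → length (foldl enter (enter R w) ws) ℕ.< length R
      go (just f) eq _ = ℕ.≤-<-trans (foldl-length (enter R w) ws)
        (subst (λ m → length (maybe′ _ R m) ℕ.< length R) (sym eq)
          (filter-notAll (λ g → ¬? (g ≟ᴱ f)) R (lose (largestAt-∈ R w eq) (λ f≢f → f≢f refl))))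
      go nothing eq (here refl) with () ← subst (e ∈_) (last-nothing eq) (∈-filter⁺ (w ∈ᴱ?_) e∈R v∈e)
      go nothing eq (there v∈ws) =
        subst (λ m → length (foldl enter (maybe′ _ R m) ws) ℕ.< length R) (sym eq)
          (row-shrinks R ws e∈R v∈e v∈ws)

    vertices-unique : Unique vertices
    vertices-unique = Permutation.Unique-resp-↭ (setoid V) (↭⇒↭ₛ (↭-sym (SortV.sort-↭ (allFin n)))) (allFin⁺ n)

    ∈-vertices : ∀ v → v ∈ vertices
    ∈-vertices v = ∈-resp-↭ (↭-sym (SortV.sort-↭ (allFin n))) (∈-allFin v)

    entered-from : ∀ k i e → length (left i) ℕ.≤ k → e ∈ left i → Σ[ p ∈ ℕ × V ] uncurry HT p ≡ just e
    entered-from zero    i e len e∈ with left i | len | e∈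
    ... | [] | _ | ()
    entered-from (suc k) i e len e∈ with entered-in-row (left i) vertices vertices-unique e∈
    ... | inj₂ (v , _ , eq) = (i , v) , eq
    ... | inj₁ e∈′ = entered-from k (suc i) e
      (ℕ.≤-pred (ℕ.≤-trans (row-shrinks (left i) vertices e∈ (inj₁ refl) (∈-vertices (Edge.lo e))) len)) e∈′

  entered : ∀ e → Σ[ p ∈ ℕ × V ] uncurry HT p ≡ just e
  entered e = entered-from (length edges) 0 e ℕ.≤-refl
    (∈-resp-↭ (↭-sym (SortE.sort-↭ (allEdges graph))) (∈-allEdges graph e))

  private
    enter-∉ : ∀ R w {e} → largestAt R w ≡ just e → ¬ e ∈ enter R w
    enter-∉ R w {e} eq e∈ = proj₂ (∈-filter⁻ (λ f → ¬? (f ≟ᴱ e)) {xs = R}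
      (subst (λ m → e ∈ maybe′ (λ e → filter (λ f → ¬? (f ≟ᴱ e)) R) R m) eq e∈)) refl

    rowEntry-∈ : ∀ R vs {v e} → rowEntry R vs v ≡ just e → e ∈ R
    rowEntry-∈ R (w ∷ ws) {v} eq with v Fin.≟ w
    ... | yes refl = largestAt-∈ R v eq
    ... | no  _    = enter-⊆ R w (rowEntry-∈ (enter R w) ws eq)

    rowEntry-∉ : ∀ R vs {v e} → rowEntry R vs v ≡ just e → ¬ e ∈ foldl enter R vs
    rowEntry-∉ R (w ∷ ws) {v} eq e∈ with v Fin.≟ w
    ... | yes refl = enter-∉ R v eq (foldl-⊆ (enter R v) ws e∈)
    ... | no  _    = rowEntry-∉ (enter R w) ws eq e∈

    rowEntry-once : ∀ R vs {u v e} → rowEntry R vs u ≡ just e → rowEntry R vs v ≡ just e → u ≡ v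
    rowEntry-once R (w ∷ ws) {u} {v} eq eq′ with u Fin.≟ w | v Fin.≟ w
    ... | yes refl | yes refl = refl
    ... | yes refl | no  _    = ⊥-elim (enter-∉ R u eq (rowEntry-∈ (enter R u) ws eq′))
    ... | no  _    | yes refl = ⊥-elim (enter-∉ R v eq′ (rowEntry-∈ (enter R v) ws eq))
    ... | no  _    | no  _    = rowEntry-once (enter R w) ws eq eq′

    left-⊆ : ∀ {i j} → i ℕ.≤′ j → ∀ {e} → e ∈ left j → e ∈ left i
    left-⊆ (ℕ.≤′-reflexive refl) e∈ = e∈
    left-⊆ {j = suc j} (ℕ.≤′-step i≤j) e∈ = left-⊆ i≤j (foldl-⊆ (left j) vertices e∈)

    not-later : ∀ {i j u v e} → HT i u ≡ just e → HT j v ≡ just e → ¬ i ℕ.< j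
    not-later {i} {j} eq eq′ i<j = rowEntry-∉ (left i) vertices eq
      (left-⊆ (ℕ.≤⇒≤′ i<j) (rowEntry-∈ (left j) vertices eq′))

  entered-once : ∀ {i j u v e} → HT i u ≡ just e → HT j v ≡ just e → i ≡ j × u ≡ v
  entered-once {i} {j} eq eq′ with ℕ.<-cmp i j
  ... | tri< i<j _ _  = ⊥-elim (not-later eq eq′ i<j)
  ... | tri≈ _ refl _ = refl , rowEntry-once (left i) vertices eq eq′
  ... | tri> _ _ j<i  = ⊥-elim (not-later eq′ eq j<i)

  -- Rows are numbered from 1 here, from 0 in HT.
  ht : E → ℕ × V
  ht e = suc (proj₁ (proj₁ (entered e))) , proj₂ (proj₁ (entered e))

  height : E → ℕ
  height e = proj₁ (ht e)

module _ {n : ℕ} (G : OrderedGraph n) where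

  open OrderedGraph G

  Joins : E → V → V → Set
  Joins e u v = (u ≡ Edge.lo e × v ≡ Edge.hi e) ⊎ (u ≡ Edge.hi e × v ≡ Edge.lo e)

  data Traverses : List V → List E → Set where
    [_] : ∀ v → Traverses (v ∷ []) []
    _∷_ : ∀ {u v vs e es} → Joins e u v → Traverses (v ∷ vs) es → Traverses (u ∷ v ∷ vs) (e ∷ es)

  -- Increasing paths with at least one edge, directed as listed. Since the
  -- vertices are distinct, so are the edges, and ≤E amounts to <E here.
  record IncreasingPath : Set where
    field
      vertices   : List V
      first      : E
      rest       : List E
      traverses  : Traverses vertices (first ∷ rest)
      distinct   : Unique vertices
      increasing : Linked _≤E_ (first ∷ rest)

    edges : List E
    edges = first ∷ rest

    pathLength : ℕ
    pathLength = length edges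

    StartsWith : E → Set
    StartsWith e = first ≡ e

{-# OPTIONS --safe #-}

-- An edge that is still missing after k rows of the height table has, in the
-- first k rows of either of its columns, k larger edges by which a path may go
-- on.  Suppose a path has visited fewer than b vertices and its last edge is
-- missing after L windows of 5b rows, where n < 4^L.  Let U_i be the vertices
-- reachable by increasing paths of at most i further edges that avoid the
-- visited vertices and drop by at most i windows.  As U_i cannot grow by a
-- factor 4 each time, for some i < L the more than 4b|U_i| entries of the next
-- window in the columns of U_i that avoid the visited vertices span at most
-- 4|U_i| vertices.  They form an ordered graph with more than b edges per
-- vertex, so some edge is missing after b rows of the height table of that
-- graph, and induction on t gives a long path P from it.  The short path to the
-- start of P may meet P, but it cuts P into at most L pieces, each of which
-- continues an initial part of it.  Each round therefore costs 5bL rows and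
-- gains about 1/L of the length of P.
--
-- With b = z^(t-1) N^(t-2), N = 20 L², and 4Lz rounds this shows: an edge
-- missing after z^t N^(t-1) rows starts a path of length z^(t-1).
module Submission where

open import Data.Empty using (⊥-elim; ⊥-elim-irr)
open import Data.Fin.Base as Fin using (Fin)
import Data.Fin.Properties as Fin
open import Data.Integer.Base as ℤ using (+_)
import Data.Integer.Properties as ℤ
open import Data.List.Base
  using (List; []; _∷_; _++_; length; filter; last; foldl; allFin; concatMap; map; deduplicate)
open import Data.List.Membership.Propositional using (_∈_; _∉_; lose; find)
open import Data.List.Membership.Propositional.Properties
  using (∈-∃++; ∈-++⁺ˡ; ∈-++⁺ʳ; ∈-++⁻; ∈-allFin; ∈-filter⁺; ∈-filter⁻; ∈-map⁺; ∈-map⁻;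
         ∈-concatMap⁺; ∈-concatMap⁻; ∈-deduplicate⁺; ∈-deduplicate⁻)
open import Data.List.Properties using (length-++; length-map; length-tabulate; filter-all)
open import Data.List.Relation.Binary.Permutation.Propositional using (_↭_; ↭-sym; ↭⇒↭ₛ)
open import Data.List.Relation.Binary.Permutation.Propositional.Properties using (∈-resp-↭; ↭-length)
import Data.List.Relation.Binary.Permutation.Setoid.Properties as Permutation
open import Data.List.Relation.Binary.Subset.Propositional using (_⊆_)
open import Data.List.Relation.Unary.All as All using (All; []; _∷_)
import Data.List.Relation.Unary.All.Properties as All
open import Data.List.Relation.Unary.AllPairs using (AllPairs; []; _∷_)
import Data.List.Relation.Unary.AllPairs.Properties as AllPairs
open import Data.List.Relation.Unary.Any using (here; there)
open import Data.List.Relation.Unary.Linked using (Linked; [-]; _∷_)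
import Data.List.Relation.Unary.Linked.Properties as Linked
open import Data.List.Relation.Unary.Unique.DecPropositional.Properties using (deduplicate-!)
open import Data.List.Relation.Unary.Unique.Propositional using (Unique)
import Data.List.Relation.Unary.Unique.Propositional.Properties as Unique
import Data.List.Sort as Sort
open import Data.Maybe.Base using (just; nothing; maybe′)
open import Data.Nat.Base as ℕ using (ℕ; zero; suc; NonZero; z≤n; s≤s)
import Data.Nat.Coprimality as Coprime
open import Data.Nat.DivMod using (m/n*n≤m; m≡m%n+[m/n]*n; m%n<n; m≥n⇒m/n>0)
import Data.Nat.Properties as ℕ
open import Data.Nat.Tactic.RingSolver using (solve-∀)
open import Data.Product.Base using (∃-syntax; Σ-syntax; _×_; _,_; proj₁; proj₂; uncurry)
open import Data.Rational.Base as ℚ using (ℚ; 0ℚ; 1ℚ; ½; mkℚ; _-_; _/_)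
import Data.Rational.Properties as ℚ
import Data.Rational.Unnormalised.Base as ℚᵘ
import Data.Rational.Unnormalised.Properties as ℚᵘ
open import Data.Sum.Base using (_⊎_; inj₁; inj₂; map₂; fromInj₁)
open import Function.Base using (_∘_; id)
open import Relation.Binary.Bundles using (DecTotalOrder)
open import Relation.Binary.Consequences using (total∧dec⇒dec)
open import Relation.Binary.Construct.Closure.ReflexiveTransitive as Star using (Star; ε; _◅_; _◅◅_)
open import Relation.Binary.Definitions using (DecidableEquality; Reflexive)
open import Relation.Binary.PropositionalEquality
  using (_≡_; _≢_; refl; sym; trans; cong; cong₂; subst; subst₂; setoid)
open import Relation.Binary.Structures using (IsTotalOrder)
open import Relation.Nullary using (Dec; yes; no; ¬?; _×-dec_)
open import Defs
open ℚLemmas using () renaming (_^_ to _^ⁿ_)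

-- Rational bounds for positive reals

module _ where

  open import Data.Rational.Base using (_<_; _≤_; _*_; _+_)
  open ℚLemmas hiding (_^_)

  -- Built with `mkℚ` because `+ k / 1` normalises by a gcd and is stuck for a variable `k`;
  -- comparisons of `ι` reduce to comparisons of numerators.
  ι : ℕ → ℚ
  ι k = mkℚ (+ k) 0 (Coprime.sym (Coprime.1-coprimeTo k))

  ι-mono-≤ : ∀ {j k} → j ℕ.≤ k → ι j ≤ ι k
  ι-mono-≤ j≤k = ℚ.*≤* (ℤ.*-monoʳ-≤-nonNeg (+ 1) (ℤ.+≤+ j≤k))

  ι-mono-< : ∀ {j k} → j ℕ.< k → ι j < ι k
  ι-mono-< j<k = ℚ.*<* (ℤ.*-monoʳ-<-pos (+ 1) (ℤ.+<+ j<k))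

  ι-pos : ∀ k .{{_ : NonZero k}} → 0ℚ < ι k
  ι-pos k = ι-mono-< (ℕ.>-nonZero⁻¹ k)

  ι-+ : ∀ j k → ι (j ℕ.+ k) ≡ ι j + ι k
  ι-+ j k = ℚ.toℚᵘ-injective (ℚᵘ.≃-trans
    (ℚᵘ.≃-reflexive (cong (λ i → ℚᵘ.mkℚᵘ i 0) (sym (cong₂ ℤ._+_ (ℤ.*-identityʳ (+ j)) (ℤ.*-identityʳ (+ k))))))
    (ℚᵘ.≃-sym (ℚ.toℚᵘ-homo-+ (ι j) (ι k))))

  ι-* : ∀ j k → ι (j ℕ.* k) ≡ ι j * ι k
  ι-* j k = ℚ.toℚᵘ-injective (ℚᵘ.≃-trans
    (ℚᵘ.≃-reflexive (cong (λ i → ℚᵘ.mkℚᵘ i 0) (ℤ.pos-* j k)))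
    (ℚᵘ.≃-sym (ℚ.toℚᵘ-homo-* (ι j) (ι k))))

  ι-^ : ∀ j k → ι (j ℕ.^ k) ≡ ι j ^ⁿ k
  ι-^ j zero    = refl
  ι-^ j (suc k) = trans (ι-* j (j ℕ.^ k)) (cong (ι j *_) (ι-^ j k))

  /1≡ι : ∀ k → + k ℚ./ 1 ≡ ι k
  /1≡ι k = ℚ.↥p/↧p≡p (ι k)

  fromℕ-L⁺ : ∀ k .{{_ : NonZero k}} {q} → 0ℚ < q → q < ι k → ℝ₊.L (fromℕ k) q
  fromℕ-L⁺ k@(suc _) 0<q q<k = 0<q , ι k , q<k , ℚ.≤-reflexive (sym (/1≡ι k))

  fromℕ-L⁻ : ∀ k .{{_ : NonZero k}} {q} → ℝ₊.L (fromℕ k) q → q < ι k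
  fromℕ-L⁻ k@(suc _) (_ , r , q<r , r≤k) = ℚ.<-≤-trans q<r (subst (r ≤_) (/1≡ι k) r≤k)

  ^ᵣ-upper : ∀ x k {u v} → ℝ₊.U x u → ℝ₊.L (x ^ᵣ k) v → v ≤ u ^ⁿ k
  ^ᵣ-upper x zero    Uu Lv = ℚ.<⇒≤ (fromℕ-L⁻ 1 Lv)
  ^ᵣ-upper x (suc k) {u} {v} Uu (_ , w , v<w , p , s , Lp , Ls , w≤ps) =
    ℚ.≤-trans (ℚ.<⇒≤ v<w) (ℚ.≤-trans w≤ps (ℚ.≤-trans
      (*-monoˡ-≤ s p u (ℝ₊.L-pos (x ^ᵣ k) Ls) (ℚ.<⇒≤ (ℝ₊Lemmas.L<U x Lp Uu)))
      (*-monoʳ-≤ u s (u ^ⁿ k) (ℝ₊Lemmas.U-pos x Uu) (^ᵣ-upper x k Uu Ls))))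

  ^ᵣ-lower : ∀ x k {d v} → ℝ₊.L x d → ℝ₊.U (x ^ᵣ k) v → d ^ⁿ k ≤ v
  ^ᵣ-lower x zero    Ld (w , _ , w<v , 1≤w) = ℚ.≤-trans 1≤w (ℚ.<⇒≤ w<v)
  ^ᵣ-lower x (suc k) {d} Ld (w , _ , w<v , p , s , Up , Us , ps≤w) =
    ℚ.≤-trans (*-monoʳ-≤ d (d ^ⁿ k) s (ℝ₊.L-pos x Ld) (^ᵣ-lower x k Ld Us))
      (ℚ.≤-trans (*-monoˡ-≤ s d p (ℝ₊Lemmas.U-pos (x ^ᵣ k) Us) (ℚ.<⇒≤ (ℝ₊Lemmas.L<U x Ld Up)))
        (ℚ.≤-trans ps≤w (ℚ.<⇒≤ w<v)))

  n-coprimeTo-1+n : ∀ k → Coprime.Coprime k (suc k)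
  n-coprimeTo-1+n k = Coprime.sym (subst (λ m → Coprime.Coprime m k) (ℕ.+-comm k 1)
    (Coprime.coprime-+ (Coprime.1-coprimeTo k)))

  -- `_^ℚ_` branches on the numerator and takes the denominator as index of the root, so it reduces
  -- only once the exponent is in this normal form.
  1-1/[1+k] : ∀ k → 1ℚ ℚ.- + 1 ℚ./ suc k ≡ mkℚ (+ k) k (n-coprimeTo-1+n k)
  1-1/[1+k] k = trans (cong (λ z → 1ℚ ℚ.- z) (ℚ.↥p/↧p≡p 1/[1+k])) (ℚ.toℚᵘ-injective (ℚᵘ.≃-trans
    (ℚ.toℚᵘ-homo-+ 1ℚ (ℚ.- 1/[1+k]))
    (ℚᵘ.*≡* (cong₂ ℤ._*_ (cong +_ (ℕ.+-identityʳ k)) (cong (λ m → + suc m) (sym (ℕ.+-identityʳ k)))))))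
    where
    1/[1+k] : ℚ
    1/[1+k] = mkℚ (+ 1) k (Coprime.1-coprimeTo (suc k))

  -- The 70 in the theorem is far larger than the argument needs; the slack
  -- absorbs the rational approximations.
  log-lower : ∀ n 2≤n L .{{_ : NonZero L}} → 2 ℕ.^ L ℕ.≤ n →
              ℝ₊.L (fromℕ 70 *ᵣ log₂ n 2≤n) (ι (33 ℕ.* L))
  log-lower n 2≤n L 2^L≤n =
    ι-pos (33 ℕ.* L) {{ℕ.m*n≢0 33 L}} , ι (34 ℕ.* L) , ι-mono-< (ℕ.*-monoˡ-< L (ℕ.n<1+n 33))
    , ι 68 , ½ * ι L
    , fromℕ-L⁺ 70 (ι-pos 68) (ι-mono-< (ℕ.m≤n+m 69 1))
    , (*-pos ½ (ι L) (ℚ.positive⁻¹ ½) (ι-pos L) , ι L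
      , subst (½ * ι L <_) (ℚ.*-identityˡ (ι L)) (*-monoˡ-< (ι L) ½ 1ℚ (ι-pos L) (ℚ.*<* (ℤ.+<+ (s≤s (s≤s z≤n)))))
      , ℕ.≤-trans 2^L≤n (ℕ.≤-reflexive (sym (ℕ.*-identityʳ n))))
    , ℚ.≤-reflexive (trans (ι-* 34 L) (trans (cong (_* ι L) {ι 34} {ι 68 * ½} refl) (ℚ.*-assoc (ι 68) ½ (ι L))))

  -- No root is ever computed. If `r` is below the root, `s` below the inverse power and
  -- `m < r * s`, then `(m d^j)^(k+1) < (r s d^j)^(k+1) ≤ r^(k+1) ≤ u^k`, because `s d^j ≤ 1`; this
  -- contradicts the hypothesis.
  root-bound : ∀ k (a D : ℝ₊) j m .{{_ : NonZero m}} {u d : ℚ} → ℝ₊.U a u → ℝ₊.L D d →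
               u ^ⁿ k ≤ (ι m * d ^ⁿ j) ^ⁿ suc k →
               (a ^ℚ (1ℚ ℚ.- + 1 ℚ./ suc k)) /ᵣ (D ^ᵣ j) ≤ᵣ fromℕ m
  root-bound k a D j m {u} {d} Uu Ld u^k≤ = subst (λ p → (a ^ℚ p) /ᵣ (D ^ᵣ j) ≤ᵣ fromℕ m) (sym (1-1/[1+k] k))
    λ { q (0<q , r₀ , q<r₀ , r , s , (0<r , r′ , r<r′ , Lr′) , (0<s , s′ , s<s′ , v , Uv , vs′≡1) , r₀≤rs) →
      let d^j  = d ^ⁿ j
          0<d  = ℝ₊.L-pos D Ld
          0<dj = ^-pos d j 0<d
          d^js≤1 : s * d^j ≤ 1ℚ
          d^js≤1 = ℚ.≤-trans (*-monoˡ-≤ d^j s s′ 0<dj (ℚ.<⇒≤ s<s′))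
                     (ℚ.≤-trans (*-monoʳ-≤ s′ d^j v (ℚ.<-trans 0<s s<s′) (^ᵣ-lower D j Ld Uv))
                       (ℚ.≤-reflexive (trans (ℚ.*-comm s′ v) vs′≡1)))
          rsd≤r : r * s * d^j ≤ r
          rsd≤r = subst₂ _≤_ (sym (ℚ.*-assoc r s d^j)) (ℚ.*-identityʳ r) (*-monoʳ-≤ r (s * d^j) 1ℚ 0<r d^js≤1)
          r^t≤ : r ^ⁿ suc k ≤ u ^ⁿ k
          r^t≤ = ℚ.≤-trans (^-mono-≤ r r′ (suc k) 0<r (ℚ.<⇒≤ r<r′)) (^ᵣ-upper a k Uu Lr′)
          rs≤m : r * s ≤ ι m
          rs≤m = ℚ.≮⇒≥ λ m<rs → ℚ.<-irrefl refl (ℚ.<-≤-trans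
            (^-mono-< (ι m * d^j) (r * s * d^j) k (*-pos (ι m) d^j (ι-pos m) 0<dj) (*-monoˡ-< d^j (ι m) (r * s) 0<dj m<rs))
            (ℚ.≤-trans (^-mono-≤ (r * s * d^j) r (suc k) (*-pos (r * s) d^j (*-pos r s 0<r 0<s) 0<dj) rsd≤r)
              (ℚ.≤-trans r^t≤ u^k≤)))
      in fromℕ-L⁺ m 0<q (ℚ.<-≤-trans q<r₀ (ℚ.≤-trans r₀≤rs rs≤m)) }

  -- The floor of a real is not computable, but locatedness decides between `1 + A < a` and
  -- `a < 2 + A`. Raising `A` from 0 until the second answer comes gives `A < a < A + 2`; the bound
  -- `a < h` makes this stop.
  integer-part : ∀ a h .{{_ : NonZero h}} → a <ᵣ fromℕ h →
                 ∃[ A ] A ℕ.< h × (∃[ p ] ι A < p × ℝ₊.L a p) × ℝ₊.U a (ι (2 ℕ.+ A))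
  integer-part a h (q , Uq , q<h) = climb h 0 refl (let l , Ll = L-inhabited in l , L-pos Ll , Ll)
    where
    open ℝ₊ a
    climb : ∀ k A → A ℕ.+ k ≡ h → (∃[ p ] ι A < p × L p) →
            ∃[ A ] A ℕ.< h × (∃[ p ] ι A < p × L p) × U (ι (2 ℕ.+ A))
    climb zero A A≡h (p , A<p , Lp) = ⊥-elim (ℚ.<-asym (ℝ₊Lemmas.L<U a Lp Uq)
      (ℚ.<-trans (fromℕ-L⁻ h q<h) (subst (λ k → ι k < p) (trans (sym (ℕ.+-identityʳ A)) A≡h) A<p)))
    climb (suc k) A A+k≡h below with located (ι-pos (1 ℕ.+ A)) (ι-mono-< (ℕ.n<1+n (1 ℕ.+ A)))
    ... | inj₁ L1+A = climb k (suc A) (trans (sym (ℕ.+-suc A k)) A+k≡h) (L-open L1+A)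
    ... | inj₂ U2+A = A , subst (A ℕ.<_) A+k≡h (ℕ.m<m+n A (s≤s z≤n)) , below , U2+A

  -- A lower bound of the sum needs a summand strictly below `g`. The margin `p - A > 0` provides
  -- it: take `x = g + A - p` if this is positive, and any small `x` otherwise.
  drop-bound : ∀ a h g .{{_ : NonZero h}} .{{_ : NonZero g}} {A p} → ι A < p → ℝ₊.L a p → h ℕ.≤ g ℕ.+ A →
               fromℕ h ≤ᵣ fromℕ g +ᵣ a
  drop-bound a h g {A} {p} A<p Lp h≤g+A q Lq =
    let x , 0<x , x<g , g+A≤x+p = split-sum
    in ℝ₊.L-pos (fromℕ h) Lq , ι h , fromℕ-L⁻ h Lq , x , p , fromℕ-L⁺ g 0<x x<g , Lp
       , ℚ.≤-trans (ℚ.≤-trans (ι-mono-≤ h≤g+A) (ℚ.≤-reflexive (ι-+ g A))) g+A≤x+p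
    where
    split-sum : ∃[ x ] 0ℚ < x × x < ι g × ι g + ι A ≤ x + p
    split-sum with ι g + ι A ℚ.≤? p
    ... | yes g+A≤p = let x , 0<x , x<g = dense 0ℚ (ι g) (ι-pos g)
                      in x , 0<x , x<g , ℚ.≤-trans g+A≤p (p≤q+p p x 0<x)
    ... | no  g+A≰p = let x , 0<x , p+x≡ = difference p (ι g + ι A) (ℚ.≰⇒> g+A≰p)
                      in x , 0<x
                         , ℚ.≰⇒> (λ g≤x → ℚ.<-irrefl refl (subst (ι g + ι A <_) (trans (ℚ.+-comm x p) p+x≡)
                             (ℚ.+-mono-≤-< g≤x A<p)))
                         , ℚ.≤-reflexive (trans (sym p+x≡) (ℚ.+-comm p x))

open import Data.Nat.Base using (_≤_; _<_; _+_; _*_; _^_)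
open import Data.Nat.Base using () renaming (_*_ to _*ℕ_)

-- Lists and natural numbers

module _ {A : Set} where

  Unique-resp-↭ : {xs ys : List A} → xs ↭ ys → Unique xs → Unique ys
  Unique-resp-↭ p = Permutation.Unique-resp-↭ (setoid A) (↭⇒↭ₛ p)

  Unique∧⊆⇒length≤ : {xs ys : List A} → Unique xs → xs ⊆ ys → length xs ≤ length ys
  Unique∧⊆⇒length≤ [] _ = z≤n
  Unique∧⊆⇒length≤ {x ∷ xs} (x∉xs ∷ xs!) xs⊆ys with ∈-∃++ (xs⊆ys (here refl))
  ... | as , bs , refl = begin
    suc (length xs)               ≤⟨ s≤s (Unique∧⊆⇒length≤ xs! xs⊆as++bs) ⟩
    suc (length (as ++ bs))       ≡⟨ cong suc (length-++ as) ⟩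
    suc (length as + length bs)   ≡⟨ ℕ.+-suc (length as) (length bs) ⟨
    length as + suc (length bs)   ≡⟨ length-++ as ⟨
    length (as ++ x ∷ bs)         ∎
    where
    open ℕ.≤-Reasoning
    xs⊆as++bs : xs ⊆ as ++ bs
    xs⊆as++bs z∈xs with ∈-++⁻ as (xs⊆ys (there z∈xs))
    ... | inj₁ z∈as         = ∈-++⁺ˡ z∈as
    ... | inj₂ (here refl)  = ⊥-elim (All.lookup x∉xs z∈xs refl)
    ... | inj₂ (there z∈bs) = ∈-++⁺ʳ as z∈bs

  length-filter-≢ : (_≟_ : DecidableEquality A) (x : A) {xs : List A} → Unique xs →
    length xs ≤ suc (length (filter (λ y → ¬? (y ≟ x)) xs))
  length-filter-≢ _≟_ x [] = z≤n
  length-filter-≢ _≟_ x {y ∷ ys} (y∉ys ∷ ys!) with y ≟ x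
  ... | no  _    = s≤s (length-filter-≢ _≟_ x ys!)
  ... | yes refl = s≤s (ℕ.≤-reflexive (cong length
    (sym (filter-all (λ z → ¬? (z ≟ x)) (All.map (λ x≢z z≡x → x≢z (sym z≡x)) y∉ys)))))

  last-∈ : {xs : List A} {m : A} → last xs ≡ just m → m ∈ xs
  last-∈ {_ ∷ []}     refl = here refl
  last-∈ {_ ∷ y ∷ ys} eq   = there (last-∈ {y ∷ ys} eq)

  last-maximum : {_≼_ : A → A → Set} → Reflexive _≼_ → {xs : List A} → AllPairs _≼_ xs →
                 ∀ {x} → x ∈ xs → ∃[ m ] last xs ≡ just m × x ≼ m
  last-maximum ≼-refl {x ∷ []}     _          (here refl) = x , refl , ≼-refl
  last-maximum ≼-refl {_ ∷ y ∷ ys} (x≼ ∷ pys) (here refl) with last-maximum ≼-refl pys (here refl)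
  ... | m , eq , _ = m , eq , All.lookup x≼ (last-∈ eq)
  last-maximum ≼-refl {_ ∷ y ∷ ys} (_ ∷ pys)  (there x∈)  = last-maximum ≼-refl pys x∈

-- A copy of the private construction of the same name in Defs, so that the
-- lists sorted there are sorted for the orders below.
decTotalOrder : {A : Set} {_≼_ : A → A → Set} →
                DecidableEquality A → IsTotalOrder _≡_ _≼_ → DecTotalOrder _ _ _
decTotalOrder _≟_ isTotalOrder = record
  { isDecTotalOrder = record
    { isTotalOrder = isTotalOrder
    ; _≟_          = _≟_
    ; _≤?_         = total∧dec⇒dec reflexive antisym total _≟_
    }
  }
  where open IsTotalOrder isTotalOrder

-- Arithmetic of the parameters `r`, `L` and `z`.

-- `r` is the gain of one round: `4 * L` rounds add up to `m`, while `L` stretches of `r + 1` edges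
-- fit into a path of length `m`. The quotient of `m` by `2 * L` does both unless it is 0; a gain of
-- 1 needs no long path.
stride : ∀ L .{{_ : NonZero L}} m → ∃[ r ] m ≤ r * (4 * L) × (r ≡ 1 ⊎ L * suc r ≤ m)
stride L@(suc _) m with 2 * L ℕ.≤? m
... | no  m<2L = 1 , (begin
    m             ≤⟨ ℕ.<⇒≤ (ℕ.≰⇒> m<2L) ⟩
    2 * L         ≤⟨ ℕ.*-monoˡ-≤ L {2} {4} (s≤s (s≤s z≤n)) ⟩
    4 * L         ≡⟨ ℕ.*-identityˡ (4 * L) ⟨
    1 * (4 * L)   ∎) , inj₁ refl
    where open ℕ.≤-Reasoning
... | yes 2L≤m = r , (begin
    m                           ≡⟨ m≡m%n+[m/n]*n m (2 * L) ⟩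
    m ℕ.% (2 * L) + r * (2 * L) ≤⟨ ℕ.+-monoˡ-≤ (r * (2 * L)) (ℕ.<⇒≤ (m%n<n m (2 * L))) ⟩
    2 * L + r * (2 * L)         ≤⟨ ℕ.+-monoˡ-≤ (r * (2 * L)) (ℕ.m≤n*m (2 * L) r {{ℕ.>-nonZero 1≤r}}) ⟩
    r * (2 * L) + r * (2 * L)   ≡⟨ double r L ⟩
    r * (4 * L)                 ∎) , inj₂ (begin
    L * (1 + r)                 ≤⟨ ℕ.*-monoʳ-≤ L (ℕ.+-monoˡ-≤ r 1≤r) ⟩
    L * (r + r)                 ≡⟨ double′ r L ⟩
    r * (2 * L)                 ≤⟨ m/n*n≤m m (2 * L) ⟩
    m                           ∎)
    where
    open ℕ.≤-Reasoning
    r : ℕ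
    r = m ℕ./ (2 * L)
    1≤r : 1 ≤ r
    1≤r = m≥n⇒m/n>0 {m} {2 * L} 2L≤m
    double : ∀ r L → r * (2 * L) + r * (2 * L) ≡ r * (4 * L)
    double = solve-∀
    double′ : ∀ r L → L * (r + r) ≡ r * (2 * L)
    double′ = solve-∀

-- If `4 ^ L ≤ n`, then `2 ^ (L + 1) ≤ 4 ^ L ≤ n` as `L ≥ 1`, so `L` can be raised. The lower bound
-- on `n` makes `L` at most the logarithm; the upper one makes `L` windows suffice.
log-window : ∀ n → 2 ≤ n → ∃[ L ] NonZero L × 2 ^ L ≤ n × n < 4 ^ L
log-window n 2≤n = climb n 1 (ℕ.n≤1+n n) 2≤n
  where
  climb : ∀ k L .{{_ : NonZero L}} → n ≤ L + k → 2 ^ L ≤ n → ∃[ L ] NonZero L × 2 ^ L ≤ n × n < 4 ^ L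
  climb k L@(suc l) n≤L+k 2^L≤n with n ℕ.<? 4 ^ L
  ... | yes n<4^L = L , _ , 2^L≤n , n<4^L
  climb zero L@(suc l) n≤L+k 2^L≤n | no _ = ⊥-elim (ℕ.<-irrefl refl
    (ℕ.<-≤-trans (n<2^n L) (ℕ.≤-trans 2^L≤n (ℕ.≤-trans n≤L+k (ℕ.≤-reflexive (ℕ.+-identityʳ L))))))
    where
    n<2^n : ∀ n → n < 2 ^ n
    n<2^n zero    = s≤s z≤n
    n<2^n (suc n) = ℕ.+-mono-≤ (ℕ.m^n>0 2 n) (ℕ.≤-trans (n<2^n n) (ℕ.m≤m+n (2 ^ n) 0))
  climb (suc k) L@(suc l) n≤L+k 2^L≤n | no n≮4^L =
    climb k (suc L) (ℕ.≤-trans n≤L+k (ℕ.≤-reflexive (ℕ.+-suc L k))) (begin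
      2 ^ (2 + l)      ≤⟨ ℕ.^-monoʳ-≤ 2 (s≤s (s≤s (ℕ.m≤m+n l _))) ⟩
      2 ^ (2 + (l + l))    ≡⟨ cong (2 ^_) (double l) ⟩
      2 ^ (2 * L)      ≡⟨ ℕ.^-*-assoc 2 2 L ⟨
      4 ^ L              ≤⟨ ℕ.≮⇒≥ n≮4^L ⟩
      n                    ∎)
    where
    open ℕ.≤-Reasoning
    double : ∀ l → 2 + (l + l) ≡ 2 * suc l
    double = solve-∀

root-floor : ∀ N .{{_ : NonZero N}} t A →
             ∃[ z ] z ^ suc t * N ≤ A × A < suc z ^ suc t * N
root-floor N t A = climb A 0 refl z≤n
  where
  climb : ∀ k z → z + k ≡ A → z ^ suc t * N ≤ A → ∃[ z ] z ^ suc t * N ≤ A × A < suc z ^ suc t * N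
  climb k z z+k≡A z≤ with suc z ^ suc t * N ℕ.≤? A
  ... | no  z≰ = z , z≤ , ℕ.≰⇒> z≰
  climb zero    z z+k≡A _ | yes 1+z≤ = ⊥-elim (ℕ.<-irrefl refl (begin-strict
    A                        ≡⟨ trans (sym z+k≡A) (ℕ.+-identityʳ z) ⟩
    z                        <⟨ ℕ.n<1+n z ⟩
    suc z                    ≤⟨ ℕ.m≤m*n (suc z) (suc z ^ t) {{ℕ.m^n≢0 (suc z) t}} ⟩
    suc z ^ suc t          ≤⟨ ℕ.m≤m*n (suc z ^ suc t) N ⟩
    suc z ^ suc t * N    ≤⟨ 1+z≤ ⟩
    A                        ∎))
    where open ℕ.≤-Reasoning
  climb (suc k) z z+k≡A _ | yes 1+z≤ = climb k (suc z) (trans (sym (ℕ.+-suc z k)) z+k≡A) 1+z≤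

^-distribʳ-* : ∀ o m n → (m * n) ^ o ≡ m ^ o * n ^ o
^-distribʳ-* zero    m n = refl
^-distribʳ-* (suc o) m n = trans (cong (m * n *_) (^-distribʳ-* o m n))
  (ℕ.[m*n]*[o*p]≡[m*o]*[n*p] m n (m ^ o) (n ^ o))

20L²^t≢0 : ∀ L t .{{_ : NonZero L}} → NonZero ((20 * (L * L)) ^ t)
20L²^t≢0 L t = ℕ.m^n≢0 (20 * (L * L)) t {{ℕ.m*n≢0 20 (L * L) {{_}} {{ℕ.m*n≢0 L L}}}}

-- The slack 80 L² ≤ (33 L)² absorbs the losses in A + 2 ≤ 2 (A + 1) and, for
-- z > 0, in z + 1 ≤ 2 z.
power-slack : ∀ L .{{_ : NonZero L}} t {A z m} .{{_ : NonZero m}} →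
  A < suc z ^ suc t * (20 * (L * L)) ^ t → z ^ t ≤ m →
  (2 + A) ^ t ≤ (m * (33 * L) ^ (2 * suc t)) ^ suc t
power-slack L t {A} {z} {m} A< z^t≤m = begin
  (2 + A) ^ t
    ≤⟨ ℕ.^-monoˡ-≤ t (begin
         2 + A                    ≤⟨ ℕ.+-monoʳ-≤ 2 (ℕ.m≤m+n A A) ⟩
         2 + (A + A)              ≡⟨ double A ⟩
         2 * suc A                ≤⟨ ℕ.*-monoʳ-≤ 2 A< ⟩
         2 * (Z ^ T * N ^ t)      ∎) ⟩
  (2 * (Z ^ T * N ^ t)) ^ t
    ≡⟨ trans (^-distribʳ-* t 2 (Z ^ T * N ^ t)) (cong (2 ^ t *_) (^-distribʳ-* t (Z ^ T) (N ^ t))) ⟩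
  2 ^ t * ((Z ^ T) ^ t * (N ^ t) ^ t)
    ≡⟨ cong (λ x → 2 ^ t * (x * (N ^ t) ^ t)) swap ⟩
  2 ^ t * ((Z ^ t) ^ T * (N ^ t) ^ t)
    ≤⟨ ℕ.*-mono-≤ 2^t≤ (ℕ.*-mono-≤ (ℕ.^-monoˡ-≤ T Z^t≤) N^tt≤) ⟩
  (2 ^ T) ^ T * ((2 ^ T * m) ^ T * (N ^ T) ^ T)
    ≡⟨ cong ((2 ^ T) ^ T *_) (^-distribʳ-* T (2 ^ T * m) (N ^ T)) ⟨
  (2 ^ T) ^ T * (2 ^ T * m * N ^ T) ^ T
    ≡⟨ ^-distribʳ-* T (2 ^ T) (2 ^ T * m * N ^ T) ⟨
  (2 ^ T * (2 ^ T * m * N ^ T)) ^ T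
    ≡⟨ cong (_^ T) (rearrange (2 ^ T) m (N ^ T)) ⟩
  (m * (2 ^ T * (2 ^ T * N ^ T))) ^ T
    ≡⟨ cong (λ x → (m * x) ^ T) merge ⟩
  (m * (2 * (2 * N)) ^ T) ^ T
    ≤⟨ ℕ.^-monoˡ-≤ T (ℕ.*-monoʳ-≤ m (ℕ.^-monoˡ-≤ T 4N≤)) ⟩
  (m * ((33 * L) ^ 2) ^ T) ^ T
    ≡⟨ cong (λ x → (m * x) ^ T) (ℕ.^-*-assoc (33 * L) 2 T) ⟩
  (m * (33 * L) ^ (2 * T)) ^ T ∎
  where
  open ℕ.≤-Reasoning
  T Z N : ℕ
  T = suc t
  Z = suc z
  N = 20 * (L * L)
  instance
    N≢0 : NonZero N
    N≢0 = ℕ.m*n≢0 20 (L * L) {{_}} {{ℕ.m*n≢0 L L}}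
  double : ∀ A → 2 + (A + A) ≡ 2 * suc A
  double = solve-∀
  rearrange : ∀ p m q → p * (p * m * q) ≡ m * (p * (p * q))
  rearrange = solve-∀
  swap : (Z ^ T) ^ t ≡ (Z ^ t) ^ T
  swap = trans (ℕ.^-*-assoc Z T t) (trans (cong (Z ^_) (ℕ.*-comm T t)) (sym (ℕ.^-*-assoc Z t T)))
  merge : 2 ^ T * (2 ^ T * N ^ T) ≡ (2 * (2 * N)) ^ T
  merge = sym (trans (^-distribʳ-* T 2 (2 * N)) (cong (2 ^ T *_) (^-distribʳ-* T 2 N)))
  N^tt≤ : (N ^ t) ^ t ≤ (N ^ T) ^ T
  N^tt≤ = ℕ.≤-trans (ℕ.^-monoʳ-≤ (N ^ t) {{ℕ.m^n≢0 N t}} (ℕ.n≤1+n t))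
    (ℕ.^-monoˡ-≤ T (ℕ.^-monoʳ-≤ N (ℕ.n≤1+n t)))
  2^t≤ : 2 ^ t ≤ (2 ^ T) ^ T
  2^t≤ = ℕ.≤-trans (ℕ.^-monoʳ-≤ 2 (ℕ.≤-trans (ℕ.n≤1+n t) (ℕ.m≤m*n T T)))
    (ℕ.≤-reflexive (sym (ℕ.^-*-assoc 2 T T)))
  Z^t≤ : Z ^ t ≤ 2 ^ T * m
  Z^t≤ = Z^t≤′ z z^t≤m
    where
    Z^t≤′ : ∀ z → z ^ t ≤ m → suc z ^ t ≤ 2 ^ T * m
    Z^t≤′ zero      _     =
      ℕ.≤-trans (ℕ.≤-reflexive (ℕ.^-zeroˡ t)) (ℕ.*-mono-≤ (ℕ.m^n>0 2 T) (ℕ.>-nonZero⁻¹ m))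
    Z^t≤′ z@(suc y) z^t≤m = begin
      suc z ^ t       ≤⟨ ℕ.^-monoˡ-≤ t (ℕ.≤-trans (s≤s (s≤s (ℕ.m≤m+n y _))) (ℕ.≤-reflexive (double y))) ⟩
      (2 * z) ^ t     ≡⟨ ^-distribʳ-* t 2 z ⟩
      2 ^ t * z ^ t   ≤⟨ ℕ.*-mono-≤ (ℕ.^-monoʳ-≤ 2 (ℕ.n≤1+n t)) z^t≤m ⟩
      2 ^ T * m       ∎
  4N≤ : 2 * (2 * N) ≤ (33 * L) ^ 2
  4N≤ = begin
    2 * (2 * (20 * (L * L)))    ≡⟨ regroup L ⟩
    80 * (L * L)                ≤⟨ ℕ.*-monoˡ-≤ (L * L) (ℕ.m≤m+n 80 1009) ⟩
    1089 * (L * L)              ≡⟨ square L ⟩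
    (33 * L) ^ 2                ∎
    where
    regroup : ∀ L → 2 * (2 * (20 * (L * L))) ≡ 80 * (L * L)
    regroup = solve-∀
    square : ∀ L → 1089 * (L * L) ≡ 33 * L * (33 * L * 1)
    square = solve-∀

ι-power-slack : ∀ L .{{_ : NonZero L}} t {A z m} .{{_ : NonZero m}} →
    A < suc z ^ suc t * (20 * (L * L)) ^ t → z ^ t ≤ m →
    ι (2 + A) ^ⁿ t ℚ.≤ (ι m ℚ.* ι (33 * L) ^ⁿ (2 * suc t)) ^ⁿ suc t
ι-power-slack L t {A} {z} {m} A<z z^t≤m =
  subst₂ ℚ._≤_ (ι-^ (2 + A) t)
    (trans (ι-^ (m * d ^ j) (suc t)) (cong (_^ⁿ suc t) (trans (ι-* m (d ^ j)) (cong (λ y → ι m ℚ.* y) (ι-^ d j)))))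
    (ι-mono-≤ (power-slack L t {A} {z} {m} A<z z^t≤m))
  where
  d j : ℕ
  d = 33 * L
  j = 2 * suc t

-- Height tables of lists of edges

module LongPaths {n : ℕ} (G : OrderedGraph n) where

  open Edge using (lo; hi)
  open OrderedGraph G
  open HeightTable G
  module ≤E = IsTotalOrder ≤E-isTotalOrder
  module SortE = Sort (decTotalOrder _≟ᴱ_ ≤E-isTotalOrder)
  module SortV = Sort (decTotalOrder Fin._≟_ ≤V-isTotalOrder)

  open import Data.List.Membership.DecPropositional {A = V} Fin._≟_ using (_∈?_; _∉?_)

  Sorted : List E → Set
  Sorted = AllPairs _≤E_

  sort-sorted : ∀ xs → Sorted (SortE.sort xs)
  sort-sorted xs = Linked.Linked⇒AllPairs ≤E.trans (SortE.sort-↗ xs)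

  edges-sorted : Sorted edges
  edges-sorted = sort-sorted (allEdges graph)

  vertices-unique : Unique vertices
  vertices-unique = Unique-resp-↭ (↭-sym (SortV.sort-↭ (allFin n))) (Unique.allFin⁺ n)

  ∈-vertices : ∀ v → v ∈ vertices
  ∈-vertices v = ∈-resp-↭ (↭-sym (SortV.sort-↭ (allFin n))) (∈-allFin v)

  largestAt-∈ : ∀ R v {e} → largestAt R v ≡ just e → e ∈ R × v ∈ᴱ e
  largestAt-∈ R v eq = ∈-filter⁻ (v ∈ᴱ?_) {xs = R} (last-∈ eq)

  largestAt-max : ∀ {R v e} → Sorted R → e ∈ R → v ∈ᴱ e → ∃[ f ] largestAt R v ≡ just f × e ≤E f
  largestAt-max {R} {v} R↗ e∈R v∈e =
    last-maximum ≤E.refl (AllPairs.filter⁺ (v ∈ᴱ?_) R↗) (∈-filter⁺ (v ∈ᴱ?_) e∈R v∈e)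

  enter-⊆ : ∀ R v → enter R v ⊆ R
  enter-⊆ R v f∈ with largestAt R v
  ... | nothing = f∈
  ... | just e  = proj₁ (∈-filter⁻ (λ f → ¬? (f ≟ᴱ e)) f∈)

  enter-∉ : ∀ R v {e} → largestAt R v ≡ just e → e ∉ enter R v
  enter-∉ R v {e} eq e∈ with largestAt R v | eq
  ... | just e | refl = proj₂ (∈-filter⁻ (λ f → ¬? (f ≟ᴱ e)) {xs = R} e∈) refl

  enter-sorted : ∀ R v → Sorted R → Sorted (enter R v)
  enter-sorted R v R↗ with largestAt R v
  ... | nothing = R↗
  ... | just e  = AllPairs.filter⁺ (λ f → ¬? (f ≟ᴱ e)) R↗

  enter-unique : ∀ R v → Unique R → Unique (enter R v)
  enter-unique R v R! with largestAt R v
  ... | nothing = R!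
  ... | just e  = Unique.filter⁺ (λ f → ¬? (f ≟ᴱ e)) R!

  enter-length : ∀ R v → Unique R → length R ≤ suc (length (enter R v))
  enter-length R v R! with largestAt R v
  ... | nothing = ℕ.n≤1+n (length R)
  ... | just e  = length-filter-≢ _≟ᴱ_ e R!

  scan-⊆ : ∀ R vs → foldl enter R vs ⊆ R
  scan-⊆ R []       f∈ = f∈
  scan-⊆ R (v ∷ vs) f∈ = enter-⊆ R v (scan-⊆ (enter R v) vs f∈)

  scan-sorted : ∀ R vs → Sorted R → Sorted (foldl enter R vs)
  scan-sorted R []       R↗ = R↗
  scan-sorted R (v ∷ vs) R↗ = scan-sorted (enter R v) vs (enter-sorted R v R↗)

  scan-unique : ∀ R vs → Unique R → Unique (foldl enter R vs)
  scan-unique R []       R! = R!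
  scan-unique R (v ∷ vs) R! = scan-unique (enter R v) vs (enter-unique R v R!)

  rowEntry-∈ : ∀ R vs {v f} → rowEntry R vs v ≡ just f → f ∈ R × v ∈ᴱ f
  rowEntry-∈ R (w ∷ ws) {v} eq with v Fin.≟ w
  ... | yes refl = largestAt-∈ R v eq
  ... | no  _    = let f∈ , v∈f = rowEntry-∈ (enter R w) ws eq in enter-⊆ R w f∈ , v∈f

  rowEntry-∉ : ∀ R vs {v f} → rowEntry R vs v ≡ just f → f ∉ foldl enter R vs
  rowEntry-∉ R (w ∷ ws) {v} eq f∈ with v Fin.≟ w
  ... | yes refl = enter-∉ R v eq (scan-⊆ (enter R v) ws f∈)
  ... | no  _    = rowEntry-∉ (enter R w) ws eq f∈

  rowEntry-injective : ∀ R vs {u v f} → rowEntry R vs u ≡ just f → rowEntry R vs v ≡ just f → u ≡ v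
  rowEntry-injective R (w ∷ ws) {u} {v} eq eq′ with u Fin.≟ w | v Fin.≟ w
  ... | yes refl | yes refl = refl
  ... | yes refl | no  _    = ⊥-elim (enter-∉ R u eq (proj₁ (rowEntry-∈ (enter R u) ws eq′)))
  ... | no  _    | yes refl = ⊥-elim (enter-∉ R v eq′ (proj₁ (rowEntry-∈ (enter R v) ws eq)))
  ... | no  _    | no  _    = rowEntry-injective (enter R w) ws eq eq′

  -- An edge that survives a row was available to both of its columns.
  rowEntry-max : ∀ {R} vs {v e} → Sorted R → e ∈ foldl enter R vs → v ∈ᴱ e → v ∈ vs →
                 ∃[ f ] rowEntry R vs v ≡ just f × e ≤E f
  rowEntry-max {R} (w ∷ ws) {v} R↗ e∈ v∈e v∈vs with v Fin.≟ w | v∈vs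
  ... | yes refl | _           = largestAt-max R↗ (enter-⊆ R v (scan-⊆ (enter R v) ws e∈)) v∈e
  ... | no  v≢v  | here refl   = ⊥-elim (v≢v refl)
  ... | no  _    | there v∈ws = rowEntry-max ws (enter-sorted R w R↗) e∈ v∈e v∈ws

  nextRow : List E → List E
  nextRow R = foldl enter R vertices

  -- Defined for any list of edges, because the induction passes to height tables of subgraphs. Rows
  -- are taken off at the top, unlike in `left`; `left-+` reconciles the two.
  afterRows : List E → ℕ → List E
  afterRows R zero    = R
  afterRows R (suc k) = afterRows (nextRow R) k

  afterRows-+ : ∀ R k l → afterRows R (k + l) ≡ afterRows (afterRows R k) l
  afterRows-+ R zero    l = refl
  afterRows-+ R (suc k) l = afterRows-+ (nextRow R) k l

  afterRows-⊆ : ∀ R k → afterRows R k ⊆ R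
  afterRows-⊆ R zero    f∈ = f∈
  afterRows-⊆ R (suc k) f∈ = scan-⊆ R vertices (afterRows-⊆ (nextRow R) k f∈)

  afterRows-anti : ∀ R {k l} → k ≤ l → afterRows R l ⊆ afterRows R k
  afterRows-anti R {k} k≤l f∈ with ℕ.m≤n⇒∃[o]m+o≡n k≤l
  ... | o , refl = afterRows-⊆ (afterRows R k) o (subst (_ ∈_) (afterRows-+ R k o) f∈)

  afterRows-sorted : ∀ R k → Sorted R → Sorted (afterRows R k)
  afterRows-sorted R zero    R↗ = R↗
  afterRows-sorted R (suc k) R↗ = afterRows-sorted (nextRow R) k (scan-sorted R vertices R↗)

  left-+ : ∀ k i → left (k + i) ≡ afterRows (left i) k
  left-+ zero    i = refl
  left-+ (suc k) i = trans (cong left (sym (ℕ.+-suc k i))) (left-+ k (suc i))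

  ∈-left : ∀ e → e ∈ left (ℕ.pred (height e))
  ∈-left e = proj₁ (rowEntry-∈ (left (proj₁ (proj₁ (entered e)))) vertices (proj₂ (entered e)))

  left⇒height : ∀ {i f} → f ∈ left i → i < height f
  left⇒height {i} {f} f∈ = ℕ.≰⇒> λ h≤i → rowEntry-∉ (left (ℕ.pred (height f))) vertices
    (proj₂ (entered f)) (anti h≤i f∈)
    where
    anti : ∀ {k l} → k ≤ l → left l ⊆ left k
    anti {k} k≤l f∈ with ℕ.m≤n⇒∃[o]m+o≡n k≤l
    ... | o , refl = afterRows-⊆ (left k) o (subst (_ ∈_) (trans (cong left (ℕ.+-comm k o)) (left-+ o k)) f∈)

  module _ (U : List V) where

    -- A column outside `U` stays blank, since no edge of `R` contains its vertex, so a row takes at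
    -- most one edge per vertex of `U`. Hence a graph with more than `b` edges per vertex keeps an
    -- edge after `b` rows.
    scan-length : ∀ R vs → Unique R → (∀ {f v} → f ∈ R → v ∈ᴱ f → v ∈ U) →
                  length R ≤ length (filter (_∈? U) vs) + length (foldl enter R vs)
    scan-length R []       R! R⊆U = ℕ.≤-refl
    scan-length R (w ∷ ws) R! R⊆U with w ∈? U
    ... | yes _  = ℕ.≤-trans (enter-length R w R!)
      (s≤s (scan-length (enter R w) ws (enter-unique R w R!) (λ f∈ → R⊆U (enter-⊆ R w f∈))))
    ... | no w∉U = subst (λ R′ → length R ≤ length (filter (_∈? U) ws) + length (foldl enter R′ ws))
      (sym enter≡R) (scan-length R ws R! R⊆U)
      where
      enter≡R : enter R w ≡ R
      enter≡R with largestAt R w in eq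
      ... | nothing = refl
      ... | just f  = ⊥-elim (w∉U (uncurry R⊆U (largestAt-∈ R w eq)))

    afterRows-length : ∀ R k → Unique R → (∀ {f v} → f ∈ R → v ∈ᴱ f → v ∈ U) →
                       length R ≤ k * length U + length (afterRows R k)
    afterRows-length R zero    R! R⊆U = ℕ.≤-refl
    afterRows-length R (suc k) R! R⊆U = begin
      length R
        ≤⟨ scan-length R vertices R! R⊆U ⟩
      length (filter (_∈? U) vertices) + length (nextRow R)
        ≤⟨ ℕ.+-mono-≤
             (Unique∧⊆⇒length≤ (Unique.filter⁺ (_∈? U) vertices-unique)
               (λ v∈ → proj₂ (∈-filter⁻ (_∈? U) {xs = vertices} v∈)))
             (afterRows-length (nextRow R) k (scan-unique R vertices R!) (λ f∈ → R⊆U (scan-⊆ R vertices f∈))) ⟩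
      length U + (k * length U + length (afterRows (nextRow R) k))
        ≡⟨ ℕ.+-assoc (length U) (k * length U) _ ⟨
      suc k * length U + length (afterRows R (suc k)) ∎
      where open ℕ.≤-Reasoning

  -- Columns of a window, and their entries that avoid given vertices.

  column : List E → V → ℕ → List E
  column R u zero    = []
  column R u (suc w) = maybe′ (λ f → f ∷ column (nextRow R) u w) (column (nextRow R) u w)
                              (rowEntry R vertices u)

  column⁻ : ∀ R u w {f} → f ∈ column R u (suc w) →
            rowEntry R vertices u ≡ just f ⊎ f ∈ column (nextRow R) u w
  column⁻ R u w f∈ with rowEntry R vertices u
  column⁻ R u w f∈          | nothing = inj₂ f∈
  column⁻ R u w (here refl) | just f  = inj₁ refl
  column⁻ R u w (there f∈)  | just _  = inj₂ f∈

  column-∈ : ∀ R u w {f} → f ∈ column R u w → f ∈ R × u ∈ᴱ f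
  column-∈ R u (suc w) f∈ with column⁻ R u w f∈
  ... | inj₁ eq  = rowEntry-∈ R vertices eq
  ... | inj₂ f∈′ = let f∈R′ , u∈f = column-∈ (nextRow R) u w f∈′ in scan-⊆ R vertices f∈R′ , u∈f

  column-unique : ∀ R u w → Unique (column R u w)
  column-unique R u zero    = []
  column-unique R u (suc w) with rowEntry R vertices u in eq
  ... | nothing = column-unique (nextRow R) u w
  ... | just f  = All.tabulate (λ g∈ f≡g → rowEntry-∉ R vertices eq
                    (subst (_∈ nextRow R) (sym f≡g) (proj₁ (column-∈ (nextRow R) u w g∈))))
                  ∷ column-unique (nextRow R) u w

  column-injective : ∀ R u v w {f} → f ∈ column R u w → f ∈ column R v w → u ≡ v
  column-injective R u v (suc w) f∈ f∈′ with column⁻ R u w f∈ | column⁻ R v w f∈′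
  ... | inj₁ eq  | inj₁ eq′ = rowEntry-injective R vertices eq eq′
  ... | inj₁ eq  | inj₂ f∈₂ = ⊥-elim (rowEntry-∉ R vertices eq (proj₁ (column-∈ (nextRow R) v w f∈₂)))
  ... | inj₂ f∈₁ | inj₁ eq  = ⊥-elim (rowEntry-∉ R vertices eq (proj₁ (column-∈ (nextRow R) u w f∈₁)))
  ... | inj₂ f∈₁ | inj₂ f∈₂ = column-injective (nextRow R) u v w f∈₁ f∈₂

  -- In each of the `w` rows the surviving edge `h` was available to column `u`, so the entry there
  -- is neither blank nor smaller.
  column-full : ∀ R u w {h} → Sorted R → h ∈ afterRows R w → u ∈ᴱ h →
                length (column R u w) ≡ w × All (h ≤E_) (column R u w)
  column-full R u zero    R↗ h∈ u∈h = refl , []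
  column-full R u (suc w) R↗ h∈ u∈h
    with column-full (nextRow R) u w (scan-sorted R vertices R↗) h∈ u∈h
       | rowEntry-max vertices R↗ (afterRows-⊆ (nextRow R) w h∈) u∈h (∈-vertices u)
  ... | len , h≤ | f , eq , h≤f with rowEntry R vertices u | eq
  ...   | just f | refl = cong suc len , h≤f ∷ h≤

  Avoids : List V → E → Set
  Avoids S f = lo f ∉ S × hi f ∉ S

  avoids? : ∀ S f → Dec (Avoids S f)
  avoids? S f = (lo f ∉? S) ×-dec (hi f ∉? S)

  Joins-∈ᴱ : ∀ {f u v} → Joins G f u v → u ∈ᴱ f × v ∈ᴱ f
  Joins-∈ᴱ (inj₁ (refl , refl)) = inj₁ refl , inj₂ refl
  Joins-∈ᴱ (inj₂ (refl , refl)) = inj₂ refl , inj₁ refl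

  ∈ᴱ-Joins : ∀ {f u} → u ∈ᴱ f → ∃[ v ] Joins G f u v
  ∈ᴱ-Joins {f} (inj₁ refl) = hi f , inj₁ (refl , refl)
  ∈ᴱ-Joins {f} (inj₂ refl) = lo f , inj₂ (refl , refl)

  ∈ᴱ-cases : ∀ {f u v x} → Joins G f u v → x ∈ᴱ f → x ≡ u ⊎ x ≡ v
  ∈ᴱ-cases (inj₁ (refl , refl)) x∈f        = x∈f
  ∈ᴱ-cases (inj₂ (refl , refl)) (inj₁ refl) = inj₂ refl
  ∈ᴱ-cases (inj₂ (refl , refl)) (inj₂ refl) = inj₁ refl

  Joins-≢ : ∀ {f u v} → Joins G f u v → u ≢ v
  Joins-≢ {edge _ _ u<v _} (inj₁ (refl , refl)) u≡v = ⊥-elim-irr (Fin.<⇒≢ u<v u≡v)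
  Joins-≢ {edge _ _ u<v _} (inj₂ (refl , refl)) v≡u = ⊥-elim-irr (Fin.<⇒≢ u<v (sym v≡u))

  Joins-unique : ∀ {f g u v} → Joins G f u v → Joins G g u v → f ≡ g
  Joins-unique (inj₁ (refl , refl)) (inj₁ (refl , refl)) = refl
  Joins-unique {edge _ _ p _} {edge _ _ q _} (inj₁ (refl , refl)) (inj₂ (refl , refl)) =
    ⊥-elim-irr (Fin.<-asym p q)
  Joins-unique {edge _ _ p _} {edge _ _ q _} (inj₂ (refl , refl)) (inj₁ (refl , refl)) =
    ⊥-elim-irr (Fin.<-asym p q)
  Joins-unique (inj₂ (refl , refl)) (inj₂ (refl , refl)) = refl

  Avoids-∈ᴱ : ∀ {S f x} → Avoids S f → x ∈ᴱ f → x ∉ S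
  Avoids-∈ᴱ (lo∉ , _) (inj₁ refl) = lo∉
  Avoids-∈ᴱ (_ , hi∉) (inj₂ refl) = hi∉

  private
    other : V → E → V
    other u f with u Fin.≟ lo f
    ... | yes _ = hi f
    ... | no  _ = lo f

    other-Joins : ∀ {u f} → u ∈ᴱ f → Joins G f u (other u f)
    other-Joins {u} {f} u∈f with u Fin.≟ lo f | u∈f
    ... | yes u≡lo | _         = inj₁ (u≡lo , refl)
    ... | no  u≢lo | inj₁ u≡lo = ⊥-elim (u≢lo u≡lo)
    ... | no  _    | inj₂ u≡hi = inj₂ (u≡hi , refl)

  -- The graph is simple, so distinct edges at `u` have distinct other ends, at most `length S` of
  -- which lie in `S`.
  length-avoids : ∀ S {u} {xs : List E} → u ∉ S → Unique xs → All (u ∈ᴱ_) xs →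
                  length xs ≤ length S + length (filter (avoids? S) xs)
  length-avoids S {u} {xs} u∉S xs! u∈ = begin
    length xs
      ≡⟨ length-map (other u) xs ⟨
    length (map (other u) xs)
      ≤⟨ Unique∧⊆⇒length≤ (map-unique xs! u∈) (covered u∈) ⟩
    length (S ++ map (other u) (filter (avoids? S) xs))
      ≡⟨ length-++ S ⟩
    length S + length (map (other u) (filter (avoids? S) xs))
      ≡⟨ cong (λ k → length S + k) (length-map (other u) (filter (avoids? S) xs)) ⟩
    length S + length (filter (avoids? S) xs) ∎
    where
    open ℕ.≤-Reasoning

    map-unique : ∀ {xs} → Unique xs → All (u ∈ᴱ_) xs → Unique (map (other u) xs)
    map-unique []             []          = []
    map-unique (x∉xs ∷ xs!) (u∈x ∷ u∈xs) =
      All.map⁺ (All.zipWith (λ {y} (x≢y , u∈y) eq → x≢y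
        (Joins-unique (other-Joins u∈x) (subst (Joins G _ u) (sym eq) (other-Joins u∈y)))) (x∉xs , u∈xs))
      ∷ map-unique xs! u∈xs

    avoids : ∀ {f} → u ∈ᴱ f → other u f ∉ S → Avoids S f
    avoids {f} u∈f o∉S with other-Joins {u} {f} u∈f
    ... | inj₁ (u≡lo , o≡hi) = subst (_∉ S) u≡lo u∉S , subst (_∉ S) o≡hi o∉S
    ... | inj₂ (u≡hi , o≡lo) = subst (_∉ S) o≡lo o∉S , subst (_∉ S) u≡hi u∉S

    covered : ∀ {xs} → All (u ∈ᴱ_) xs → map (other u) xs ⊆ S ++ map (other u) (filter (avoids? S) xs)
    covered u∈ x∈ with ∈-map⁻ (other u) x∈
    ... | f , f∈xs , refl with other u f ∈? S
    ...   | yes o∈S = ∈-++⁺ˡ o∈S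
    ...   | no  o∉S = ∈-++⁺ʳ S (∈-map⁺ (other u) (∈-filter⁺ (avoids? S) f∈xs (avoids {f} (All.lookup u∈ f∈xs) o∉S)))

  -- Increasing paths

  -- The part of a path built so far; visited does not include the end.
  record State : Set where
    constructor ⟨_,_,_⟩
    field
      lastEdge : E
      end      : V
      visited  : List V

  open State public

  len : State → ℕ
  len = length ∘ visited

  data Step (R : List E) : State → State → Set where
    step : ∀ {g f y v S} → f ∈ R → g ≤E f → Joins G f y v → v ∉ y ∷ S →
           Step R ⟨ g , y , S ⟩ ⟨ f , v , y ∷ S ⟩

  Walk : List E → State → State → Set
  Walk R = Star (Step R)

  Walk-mono : ∀ {R R′ s t} → R ⊆ R′ → Walk R s t → Walk R′ s t
  Walk-mono R⊆R′ = Star.map λ { (step f∈ g≤f j v∉) → step (R⊆R′ f∈) g≤f j v∉ }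

  Valid : State → Set
  Valid s = end s ∈ᴱ lastEdge s × end s ∉ visited s

  Walk-valid : ∀ {R s t} → Walk R s t → Valid s → Valid t
  Walk-valid ε ok = ok
  Walk-valid (step {f = f} _ _ j v∉ ◅ ss) _ = Walk-valid ss (proj₂ (Joins-∈ᴱ {f} j) , v∉)

  Walk-lastEdge : ∀ {R s t} → Walk R s t → lastEdge s ∈ R → lastEdge t ∈ R
  Walk-lastEdge ε                     g∈ = g∈
  Walk-lastEdge (step f∈ _ _ _ ◅ ss) _  = Walk-lastEdge ss f∈

  Walk-≤E : ∀ {R s t} → Walk R s t → lastEdge s ≤E lastEdge t
  Walk-≤E ε                      = ≤E.refl
  Walk-≤E (step _ g≤f _ _ ◅ ss) = ≤E.trans g≤f (Walk-≤E ss)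

  Walk-visited : ∀ {R s t} → Walk R s t → len s ≤ len t
  Walk-visited ε                    = ℕ.≤-refl
  Walk-visited (step _ _ _ _ ◅ ss) = ℕ.≤-trans (ℕ.n≤1+n _) (Walk-visited ss)

  Walk-⊆ : ∀ {R s t} → Walk R s t → visited s ⊆ visited t
  Walk-⊆ ε                    x∈ = x∈
  Walk-⊆ (step _ _ _ _ ◅ ss) x∈ = Walk-⊆ ss (there x∈)

  -- Cut the walk where it is at `v`. As `visited t` leaves out the end of `t`, the piece is
  -- strictly shorter, which is the descent that bounds the fall-backs in `splice`.
  prefix : ∀ {R s t v} → Walk R s t → v ∈ visited t → v ∉ visited s →
           ∃[ p ] Walk R s p × end p ≡ v × len p < len t × lastEdge p ≤E lastEdge t
  prefix ε v∈ v∉ = ⊥-elim (v∉ v∈)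
  prefix {s = s} {v = v} (st@(step _ g≤f _ _) ◅ ss) v∈ v∉ with v Fin.≟ end s
  ... | yes refl = s , ε , refl , Walk-visited ss , ≤E.trans g≤f (Walk-≤E ss)
  ... | no  v≢   = let p , ss′ , rest = prefix ss v∈ (λ { (here v≡) → v≢ v≡ ; (there v∈S) → v∉ v∈S })
                   in p , st ◅ ss′ , rest

  -- Follow the second path; whenever it meets the first one, fall back to the
  -- initial part of the first path that ends at the meeting point.  As the
  -- first path gets shorter each time, this happens at most M times, and some
  -- stretch of q edges of the second path is free of meeting points.
  splice : ∀ {R R′ s t P P′} q M → R′ ⊆ R → All (Avoids (visited s)) R′ →
           Walk R s t → len t ≤ len s + M →
           end t ≡ end P → lastEdge t ≤E lastEdge P → Walk R′ P P′ →
           len P + (M + 1) * suc q ≤ suc (len P′) →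
           ∃[ t′ ] Walk R s t′ × len s + q ≤ len t′
  splice {R} {R′} {s} q M₀ R′⊆R avoids W₀ W₀≤ end≡ t≤P P₀ enough =
    follow M₀ 0 W₀ W₀≤ t≤P W₀ (Walk-visited W₀) inj₁ end≡ t≤P P₀
      (subst (λ k → _ ≤ suc k) (sym (ℕ.+-identityʳ _)) enough)
    where
    -- `t` is the initial part of the first path in use, `c` the path built from it, `P` the
    -- position on the second path, and `d` the number of its edges followed since the last
    -- fall-back. At most `M` fall-backs remain, and `enough` reserves `suc q` edges for each of
    -- them and for the final stretch.
    follow : ∀ {t c P P′} M d → Walk R s t → len t ≤ len s + M → lastEdge t ≤E lastEdge P →
             Walk R s c → d + len s ≤ len c → (∀ {x} → x ∈ visited c → x ∈ visited t ⊎ x ∈ visited P) →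
             end c ≡ end P → lastEdge c ≤E lastEdge P → Walk R′ P P′ →
             len P + (M + 1) * suc q ≤ suc (len P′ + d) →
             ∃[ t′ ] Walk R s t′ × len s + q ≤ len t′
    follow {c = c} {P} M d W t≤ t≤P C d≤ inv refl c≤P ε enough = c , C , (begin
      len s + q   ≤⟨ ℕ.+-monoʳ-≤ (len s) (ℕ.s≤s⁻¹ (ℕ.+-cancelˡ-≤ (len P) _ _ (begin
        len P + suc q               ≡⟨ cong (λ k → len P + k) (ℕ.*-identityˡ (suc q)) ⟨
        len P + 1 * suc q           ≤⟨ ℕ.+-monoʳ-≤ (len P) (ℕ.*-monoˡ-≤ (suc q) (ℕ.m≤n+m 1 M)) ⟩
        len P + (M + 1) * suc q     ≤⟨ enough ⟩
        suc (len P + d)             ≡⟨ ℕ.+-suc (len P) d ⟨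
        len P + suc d               ∎))) ⟩
      len s + d   ≡⟨ ℕ.+-comm (len s) d ⟩
      d + len s   ≤⟨ d≤ ⟩
      len c       ∎)
      where open ℕ.≤-Reasoning
    follow {t} {c} {P} {P′} M d W t≤ t≤P C d≤ inv refl c≤P (step {f = f} {v = v} f∈ P≤f j v∉ ◅ rest) enough
      with q ℕ.≤? d
    ... | yes q≤d = c , C ,
      ℕ.≤-trans (ℕ.≤-reflexive (ℕ.+-comm (len s) q)) (ℕ.≤-trans (ℕ.+-monoˡ-≤ (len s) q≤d) d≤)
    ... | no  q≰d with v ∈? visited c
    ...   | no  v∉c = follow M (suc d) W t≤ (≤E.trans t≤P P≤f)
      (C ◅◅ step (R′⊆R f∈) (≤E.trans c≤P P≤f) j
              (λ { (here v≡) → v∉ (here v≡) ; (there v∈) → v∉c v∈ }) ◅ ε)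
      (s≤s d≤)
      (λ { (here refl) → inj₂ (here refl) ; (there x∈) → map₂ there (inv x∈) })
      refl ≤E.refl rest
      (subst (suc (len P) + (M + 1) * suc q ≤_) (cong suc (sym (ℕ.+-suc (len P′) d))) (s≤s enough))
    ...   | yes v∈c = fallBack M t≤ enough
      -- The meeting point is new to the second path, hence lies on `t`; it is not in `visited s`,
      -- which the edges of `R′` avoid.
      (prefix W (fromInj₁ (λ v∈P → ⊥-elim (v∉ (there v∈P))) (inv v∈c))
                (Avoids-∈ᴱ {f = f} (All.lookup avoids f∈) (proj₂ (Joins-∈ᴱ {f} j))))
      where
      fallBack : ∀ M → len t ≤ len s + M → len P + (M + 1) * suc q ≤ suc (len P′ + d) →
                 (∃[ p ] Walk R s p × end p ≡ v × len p < len t × lastEdge p ≤E lastEdge t) →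
                 ∃[ t′ ] Walk R s t′ × len s + q ≤ len t′
      fallBack zero t≤ _ (p , W′ , _ , p<t , _) = ⊥-elim (ℕ.<-irrefl refl (ℕ.<-≤-trans p<t
        (ℕ.≤-trans t≤ (ℕ.≤-trans (ℕ.≤-reflexive (ℕ.+-identityʳ (len s))) (Walk-visited W′)))))
      fallBack (suc M) t≤ enough (p , W′ , end≡ , p<t , p≤t) =
        follow M 0 W′ (ℕ.s≤s⁻¹ (ℕ.≤-trans p<t (ℕ.≤-trans t≤ (ℕ.≤-reflexive (ℕ.+-suc (len s) M))))) p≤f
          W′ (Walk-visited W′) inj₁ end≡ p≤f rest
          -- The `suc q` edges reserved for this fall-back pay for the `d < q` abandoned ones and
          -- for the edge `f` into the meeting point.
          (ℕ.+-cancelˡ-≤ (suc d) _ _ (begin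
            suc d + (suc (len P) + (M + 1) * suc q)   ≤⟨ ℕ.+-monoˡ-≤ _ (ℕ.≰⇒> q≰d) ⟩
            q + (suc (len P) + (M + 1) * suc q)       ≡⟨ rearrange q (len P) ((M + 1) * suc q) ⟩
            len P + (suc M + 1) * suc q               ≤⟨ enough ⟩
            suc (len P′ + d)                          ≡⟨ rearrange′ (len P′) d ⟩
            d + suc (len P′ + 0)                      ≤⟨ ℕ.n≤1+n _ ⟩
            suc d + suc (len P′ + 0)                  ∎))
        where
        open ℕ.≤-Reasoning
        p≤f : lastEdge p ≤E f
        p≤f = ≤E.trans p≤t (≤E.trans t≤P P≤f)
        rearrange : ∀ q a x → q + (suc a + x) ≡ a + (suc q + x)
        rearrange = solve-∀
        rearrange′ : ∀ a d → suc (a + d) ≡ d + suc (a + 0)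
        rearrange′ = solve-∀

  Walk⇒path : ∀ {R s t} → Walk R s t → Σ[ vs ∈ List V ] Σ[ fs ∈ List E ]
    Traverses G (end s ∷ vs) fs × Linked _≤E_ (lastEdge s ∷ fs) × All (_∈ R) fs ×
    Unique (end s ∷ vs) × All (_∉ visited s) vs × length fs + len s ≡ len t
  Walk⇒path {s = s} ε = [] , [] , [ end s ] , [-] , [] , [] ∷ [] , [] , refl
  Walk⇒path {s = s} (step {f = f} {v = v} f∈ g≤f j v∉ ◅ ss) with Walk⇒path ss
  ... | vs , fs , T , ↗ , fs∈ , vs! , vs∉ , length≡ =
    v ∷ vs , f ∷ fs , j ∷ T , g≤f ∷ ↗ , f∈ ∷ fs∈
    , ((λ y≡v → v∉ (here (sym y≡v))) ∷ All.map (λ x∉ y≡x → x∉ (here (sym y≡x))) vs∉) ∷ vs!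
    , (v∉ ∘ there) ∷ All.map (_∘ there) vs∉
    , trans (sym (ℕ.+-suc (length fs) (len s))) length≡

  -- Extending a path in rounds

  ends : E → List V
  ends f = lo f ∷ hi f ∷ []

  ∈-ends⁺ : ∀ {v f} → v ∈ᴱ f → v ∈ ends f
  ∈-ends⁺ (inj₁ v≡) = here v≡
  ∈-ends⁺ (inj₂ v≡) = there (here v≡)

  ∈-ends⁻ : ∀ {v f} → v ∈ ends f → v ∈ᴱ f
  ∈-ends⁻ (here v≡)         = inj₁ v≡
  ∈-ends⁻ (there (here v≡)) = inj₂ v≡

  module Window (B : List E) (w : ℕ) (S : List V) where

    surviving : List V → List E
    surviving = concatMap (λ u → filter (avoids? S) (column B u w))

    endpoints : List V → List V
    endpoints U = deduplicate Fin._≟_ (concatMap ends (surviving U))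

    surviving⁻ : ∀ {U f} → f ∈ surviving U → ∃[ u ] u ∈ U × f ∈ column B u w × Avoids S f
    surviving⁻ {U} f∈ =
      let u , u∈U , f∈col = find (∈-concatMap⁻ (λ u → filter (avoids? S) (column B u w)) {xs = U} f∈)
          f∈′ , avoids = ∈-filter⁻ (avoids? S) {xs = column B u w} f∈col
      in u , u∈U , f∈′ , avoids

    surviving-unique : ∀ {U} → Unique U → Unique (surviving U)
    surviving-unique [] = []
    surviving-unique {u ∷ U} (u∉U ∷ U!) = Unique.++⁺
      (Unique.filter⁺ (avoids? S) (column-unique B u w)) (surviving-unique U!)
      λ (f∈ , f∈′) → let v , v∈U , f∈v , _ = surviving⁻ {U} f∈′
                       in All.lookup u∉U v∈U (column-injective B u v w
                            (proj₁ (∈-filter⁻ (avoids? S) {xs = column B u w} f∈)) f∈v)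

    surviving-length : ∀ k {U} → Sorted B → length S + k ≤ w →
                       All (λ u → u ∉ S × (∃[ h ] h ∈ afterRows B w × u ∈ᴱ h)) U →
                       length U * k ≤ length (surviving U)
    surviving-length k B↗ k≤ [] = z≤n
    surviving-length k {u ∷ U} B↗ k≤ ((u∉S , h , h∈ , u∈h) ∷ us) = begin
      k + length U * k
        ≤⟨ ℕ.+-mono-≤ (ℕ.+-cancelˡ-≤ (length S) k _ (begin
             length S + k
               ≤⟨ k≤ ⟩
             w
               ≡⟨ proj₁ (column-full B u w B↗ h∈ u∈h) ⟨
             length (column B u w)
               ≤⟨ length-avoids S u∉S (column-unique B u w) (All.tabulate (proj₂ ∘ column-∈ B u w)) ⟩
             length S + length (filter (avoids? S) (column B u w)) ∎))
           (surviving-length k B↗ k≤ us) ⟩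
      length (filter (avoids? S) (column B u w)) + length (surviving U)
        ≡⟨ length-++ (filter (avoids? S) (column B u w)) ⟨
      length (surviving (u ∷ U)) ∎
      where open ℕ.≤-Reasoning

    endpoints⁺ : ∀ {U f v} → f ∈ surviving U → v ∈ᴱ f → v ∈ endpoints U
    endpoints⁺ {f = f} f∈ v∈f = ∈-deduplicate⁺ Fin._≟_ (∈-concatMap⁺ ends (lose f∈ (∈-ends⁺ {f = f} v∈f)))

    endpoints⁻ : ∀ {U v} → v ∈ endpoints U → ∃[ f ] f ∈ surviving U × v ∈ᴱ f
    endpoints⁻ {U} v∈ =
      let f , f∈ , v∈f = find (∈-concatMap⁻ ends {xs = surviving U}
                           (∈-deduplicate⁻ Fin._≟_ (concatMap ends (surviving U)) v∈))
      in f , f∈ , ∈-ends⁻ {f = f} v∈f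

    -- If the surviving entries span few vertices, they are too many to fit
    -- into b rows of a height table of their own.
    dense : ∀ b {U} → Unique U → Sorted B → length S + suc (4 * b) ≤ w →
            All (λ u → u ∉ S × (∃[ h ] h ∈ afterRows B w × u ∈ᴱ h)) U →
            0 < length U → length (endpoints U) ≤ 4 * length U →
            ∃[ e ] e ∈ afterRows (SortE.sort (surviving U)) b
    dense b {U} U! B↗ S≤ us 0<U few = nonempty (ℕ.+-cancelˡ-< (b * length (endpoints U)) 0 _ (begin-strict
      b * length (endpoints U) + 0
        ≡⟨ ℕ.+-identityʳ _ ⟩
      b * length (endpoints U)
        ≤⟨ ℕ.*-monoʳ-≤ b few ⟩
      b * (4 * length U)
        <⟨ ℕ.+-monoˡ-< (b * (4 * length U)) 0<U ⟩
      length U + b * (4 * length U)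
        ≡⟨ rearrange b (length U) ⟩
      length U * suc (4 * b)
        ≤⟨ surviving-length (suc (4 * b)) B↗ S≤ us ⟩
      length (surviving U)
        ≡⟨ ↭-length (SortE.sort-↭ (surviving U)) ⟨
      length R′
        ≤⟨ afterRows-length (endpoints U) R′ b (Unique-resp-↭ (↭-sym (SortE.sort-↭ (surviving U))) (surviving-unique U!))
             (λ f∈ → endpoints⁺ {U} (∈-resp-↭ (SortE.sort-↭ (surviving U)) f∈)) ⟩
      b * length (endpoints U) + length (afterRows R′ b) ∎))
      where
      open ℕ.≤-Reasoning
      R′ : List E
      R′ = SortE.sort (surviving U)
      rearrange : ∀ b u → u + b * (4 * u) ≡ u * suc (4 * b)
      rearrange = solve-∀
      nonempty : ∀ {xs : List E} → 0 < length xs → ∃[ e ] e ∈ xs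
      nonempty {x ∷ _} _ = x , here refl

  -- A path from s to an edge that is missing after b rows of the height table
  -- of a part R′ of R.
  record Launch (R : List E) (s : State) (M b : ℕ) : Set where
    field
      R′        : List E
      sorted    : Sorted R′
      R′⊆R      : R′ ⊆ R
      avoids    : All (Avoids (visited s)) R′
      first     : E
      first-∈   : first ∈ afterRows R′ b
      reached   : State
      walk      : Walk R s reached
      short     : len reached ≤ len s + M
      end-∈     : end reached ∈ᴱ first
      ascending : lastEdge reached ≤E first

  -- The search for a window whose entries are dense.

  module Search (R : List E) (R↗ : Sorted R) (s : State) (s-valid : Valid s) (b : ℕ) (S<b : len s < b) where

    -- Fewer than `b` entries of a full column meet the visited vertices, which leaves at least
    -- `4 * b + 1`; on at most four times as many vertices as columns this is still more than `b`
    -- edges per vertex.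
    w : ℕ
    w = 5 * b

    S≤w : len s + suc (4 * b) ≤ w
    S≤w = ℕ.≤-trans (ℕ.≤-reflexive (ℕ.+-suc (len s) (4 * b))) (ℕ.+-monoˡ-≤ (4 * b) S<b)

    -- ℓ is the number of windows of w rows that are left, i bounds the number of
    -- steps made.
    Reached : ℕ → ℕ → V → Set
    Reached ℓ i u = ∃[ t ] Walk (afterRows R (ℓ * w)) s t × end t ≡ u ×
                           len t ≤ len s + i × lastEdge s ∈ afterRows R (ℓ * w)

    module _ (ℓ : ℕ) where

      -- The height table of `base` begins with the window in which a walk on edges missing after
      -- `suc ℓ` windows is continued. The search thus moves up the table, towards larger edges.
      base : List E
      base = afterRows R (ℓ * w)

      above⇒base : ∀ {h} → h ∈ afterRows R (suc ℓ * w) → h ∈ afterRows base w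
      above⇒base {h} = subst (h ∈_) (trans (cong (afterRows R) (ℕ.+-comm w (ℓ * w))) (afterRows-+ R (ℓ * w) w))

      open Window base w (visited s)

      down : afterRows R (suc ℓ * w) ⊆ base
      down = afterRows-anti R (ℕ.m≤n+m (ℓ * w) w)

      -- The edge `h` that makes column `u` full is the last edge of the walk to `u`; for an empty
      -- walk it is `lastEdge s`, whose survival `Reached` records separately.
      source : ∀ {i u} → Reached (suc ℓ) i u → u ∉ visited s × (∃[ h ] h ∈ afterRows base w × u ∈ᴱ h)
      source (t , W , refl , _ , s∈) =
        let t∈ᴱ , t∉ = Walk-valid W s-valid
        in t∉ ∘ Walk-⊆ W , lastEdge t , above⇒base (Walk-lastEdge W s∈) , t∈ᴱ

      base↗ : Sorted base
      base↗ = afterRows-sorted R (ℓ * w) R↗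

      column-above : ∀ {h u f} → h ∈ afterRows R (suc ℓ * w) → u ∈ᴱ h → f ∈ column base u w → h ≤E f
      column-above {u = u} h∈ u∈h = All.lookup (proj₂ (column-full base u w base↗ (above⇒base h∈) u∈h))

      -- Let `f` be an entry in column `u` that contains `v`. The walk to `u` either ends at `v`, or
      -- has passed `v` and can be cut there, or can be continued along `f`, which is at least its
      -- last edge.
      spread : ∀ {i U} → All (Reached (suc ℓ) i) U → ∀ {v} → v ∈ endpoints U → Reached ℓ (suc i) v
      spread {i} {U} reached {v} v∈ with endpoints⁻ {U} v∈
      ... | f , f∈ , v∈f with surviving⁻ {U} f∈
      ... | u , u∈U , f∈u , avoids with All.lookup reached u∈U
      ... | t , W , refl , short , s∈ with v Fin.≟ end t | v ∈? visited t
      ... | yes refl | _ = t , Walk-mono down W , refl , ℕ.≤-trans short (ℕ.+-monoʳ-≤ (len s) (ℕ.n≤1+n i)) , down s∈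
      ... | no v≢u | yes v∈t =
        let p , W′ , eq , p<t , _ = prefix (Walk-mono down W) v∈t (Avoids-∈ᴱ {f = f} avoids v∈f)
        in p , W′ , eq , ℕ.≤-trans (ℕ.<⇒≤ p<t) (ℕ.≤-trans short (ℕ.+-monoʳ-≤ (len s) (ℕ.n≤1+n i))) , down s∈
      ... | no v≢u | no v∉t =
        ⟨ f , v , end t ∷ visited t ⟩
        , Walk-mono down W ◅◅ step (proj₁ (column-∈ base (end t) w f∈u))
            (column-above (Walk-lastEdge W s∈) (proj₁ (Walk-valid W s-valid)) f∈u) joins
            (λ { (here v≡) → v≢u v≡ ; (there v∈) → v∉t v∈ }) ◅ ε
        , refl , ℕ.≤-trans (s≤s short) (ℕ.≤-reflexive (sym (ℕ.+-suc (len s) i))) , down s∈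
        where
        joins : Joins G f (end t) v
        joins with ∈ᴱ-Joins {f} (proj₂ (column-∈ base (end t) w f∈u))
        ... | x , j with ∈ᴱ-cases {f} j v∈f
        ...   | inj₁ v≡u  = ⊥-elim (v≢u v≡u)
        ...   | inj₂ refl = j

      launch : ∀ {i U} → Unique U → 0 < length U → All (Reached (suc ℓ) i) U →
               length (endpoints U) ≤ 4 * length U → Launch R s i b
      launch {i} {U} U! 0<U reached few with dense b U! base↗ S≤w (All.map source reached) 0<U few
      ... | e , e∈
        with surviving⁻ {U} (∈-resp-↭ (SortE.sort-↭ (surviving U)) (afterRows-⊆ (SortE.sort (surviving U)) b e∈))
      ... | u , u∈U , e∈u , _ with All.lookup reached u∈U
      ... | t , W , refl , short , s∈ = record
        { R′ = SortE.sort (surviving U)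
        ; sorted = sort-sorted (surviving U)
        ; R′⊆R = λ f∈ → let u , _ , f∈u , _ = surviving⁻ {U} (∈-resp-↭ (SortE.sort-↭ (surviving U)) f∈)
                        in afterRows-⊆ R (ℓ * w) (proj₁ (column-∈ base u w f∈u))
        ; avoids = All.tabulate (λ f∈ →
            let _ , _ , _ , av = surviving⁻ {U} (∈-resp-↭ (SortE.sort-↭ (surviving U)) f∈) in av)
        ; first = e
        ; first-∈ = e∈
        ; reached = t
        ; walk = Walk-mono (afterRows-⊆ R (suc ℓ * w)) W
        ; short = short
        ; end-∈ = proj₂ (column-∈ base (end t) w e∈u)
        ; ascending = column-above (Walk-lastEdge W s∈) (proj₁ (Walk-valid W s-valid)) e∈u
        }

    -- Each failure more than quadruples `U` and uses one window, so `n < 4 ^ ℓ * length U`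
    -- persists; at `ℓ = 0` it would give `U` more than `n` vertices. Success therefore comes while
    -- `ℓ > 0`, that is, with `i ≤ M`.
    search : ∀ {M} ℓ i {U} → i + ℓ ≡ suc M → Unique U → 0 < length U → All (Reached ℓ i) U →
             n < 4 ^ ℓ * length U → Launch R s M b
    search zero i {U} _ U! _ _ n<U = ⊥-elim (ℕ.<-irrefl refl (ℕ.<-≤-trans n<U (begin
      1 * length U          ≡⟨ ℕ.*-identityˡ (length U) ⟩
      length U              ≤⟨ Unique∧⊆⇒length≤ U! (λ {v} _ → ∈-allFin v) ⟩
      length (allFin n)     ≡⟨ length-tabulate id ⟩
      n                     ∎)))
      where open ℕ.≤-Reasoning
    search {M} (suc ℓ) i {U} i+ℓ U! 0<U reached n<
      with length (Window.endpoints (base ℓ) w (visited s) U) ℕ.≤? 4 * length U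
    ... | yes few = weaken (launch ℓ U! 0<U reached few)
      where
      i≤M : i ≤ M
      i≤M = ℕ.s≤s⁻¹ (ℕ.≤-trans (s≤s (ℕ.m≤m+n i ℓ)) (ℕ.≤-reflexive (trans (sym (ℕ.+-suc i ℓ)) i+ℓ)))
      weaken : Launch R s i b → Launch R s M b
      weaken l = record { Launch l hiding (short) ; short = ℕ.≤-trans (Launch.short l) (ℕ.+-monoʳ-≤ (len s) i≤M) }
    ... | no many = search ℓ (suc i) (trans (sym (ℕ.+-suc i ℓ)) i+ℓ)
      (deduplicate-! Fin._≟_ _) (ℕ.≤-trans (s≤s z≤n) (ℕ.≰⇒> many)) (All.tabulate (spread ℓ {i} {U} reached))
      (begin-strict
        n                             <⟨ n< ⟩
        4 ^ suc ℓ * length U          ≡⟨ cong (_* length U) (ℕ.*-comm 4 (4 ^ ℓ)) ⟩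
        4 ^ ℓ * 4 * length U          ≡⟨ ℕ.*-assoc (4 ^ ℓ) 4 (length U) ⟩
        4 ^ ℓ * (4 * length U)        ≤⟨ ℕ.*-monoʳ-≤ (4 ^ ℓ) (ℕ.<⇒≤ (ℕ.≰⇒> many)) ⟩
        4 ^ ℓ * length (Window.endpoints (base ℓ) w (visited s) U)  ∎)
      where open ℕ.≤-Reasoning

  -- Rounds, and the induction on `t`.

  -- All `R` and both directions of `e` are covered, because a launch supplies its own subgraph and
  -- may reach its first edge at either end. Since `visited` omits the end, `len t` is the number of
  -- edges including `e`.
  Extendible : (rows length : ℕ) → Set
  Extendible b m = ∀ R → Sorted R → ∀ {e x y} → e ∈ afterRows R b → Joins G e x y →
                   ∃[ t ] Walk R ⟨ e , y , x ∷ [] ⟩ t × m ≤ len t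

  module _ (L : ℕ) .{{_ : NonZero L}} (n<4^L : n < 4 ^ L) where

    module _ (b m : ℕ) (ih : Extendible b m) where

      -- A nonempty walk to the launch edge has already gained an edge; after an empty one the
      -- launch edge itself is the gain.
      advance : ∀ {R s} → Launch R s (ℕ.pred L) b → ∃[ t ] Walk R s t × len s + 1 ≤ len t
      advance {R} {s} l with ∈ᴱ-Joins {Launch.first l} (Launch.end-∈ l)
      ... | v , j = one-step walk ascending j
        where
        open Launch l
        first∈ : first ∈ R′
        first∈ = afterRows-⊆ R′ b first-∈
        one-step : ∀ {t} → Walk R s t → lastEdge t ≤E first → Joins G first (end t) v →
                   ∃[ t′ ] Walk R s t′ × len s + 1 ≤ len t′
        one-step ε ≤first j = _
          , step (R′⊆R first∈) ≤first j
              (λ { (here v≡) → Joins-≢ {first} j (sym v≡)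
                 ; (there v∈) → Avoids-∈ᴱ {f = first} (All.lookup avoids first∈)
                                    (proj₂ (Joins-∈ᴱ {first} j)) v∈ }) ◅ ε
          , ℕ.≤-reflexive (ℕ.+-comm (len s) 1)
        one-step (st@(step _ _ _ _) ◅ W) _ _ =
          _ , st ◅ W , ℕ.≤-trans (ℕ.≤-reflexive (ℕ.+-comm (len s) 1)) (Walk-visited W)

      advance-far : ∀ {R s} r → L * suc r ≤ m → Launch R s (ℕ.pred L) b →
                    ∃[ t ] Walk R s t × len s + r ≤ len t
      advance-far r Lr≤m l with ∈ᴱ-Joins {Launch.first l} (Launch.end-∈ l)
      ... | v , j with ih (Launch.R′ l) (Launch.sorted l) (Launch.first-∈ l) j
      ...   | P′ , P , m≤P =
        -- The second path starts with no visited vertices: the induction hypothesis knows nothing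
        -- of `s`, and the walk to `reached` is reconciled with it by `splice`.
        splice {P = ⟨ lastEdge reached , end reached , [] ⟩} r (ℕ.pred L) R′⊆R avoids walk short refl ≤E.refl
        (step (afterRows-⊆ R′ b first-∈) ascending j (λ { (here v≡) → Joins-≢ {first} j (sym v≡) }) ◅ P)
        (ℕ.≤-trans (ℕ.≤-reflexive (cong (_* suc r) (trans (ℕ.+-comm (ℕ.pred L) 1) (ℕ.suc-pred L))))
          (ℕ.≤-trans Lr≤m (ℕ.≤-trans m≤P (ℕ.n≤1+n _))))
        where open Launch l

      from-launch : ∀ {R s r} → r ≡ 1 ⊎ L * suc r ≤ m → Launch R s (ℕ.pred L) b →
                    ∃[ t ] Walk R s t × len s + r ≤ len t
      from-launch         (inj₁ refl) = advance
      from-launch {r = r} (inj₂ Lr≤m) = advance-far r Lr≤m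

      round : ∀ {R s r} → r ≡ 1 ⊎ L * suc r ≤ m → Sorted R → Valid s → len s < b →
              lastEdge s ∈ afterRows R (L * (5 * b)) → ∃[ t ] Walk R s t × len s + r ≤ len t
      round {R} {s} r-small R↗ s-valid S<b s∈ = from-launch r-small
        (search L 0 (sym (ℕ.suc-pred L)) ([] ∷ []) (s≤s z≤n) ((s , ε , refl , ℕ.m≤m+n (len s) 0 , s∈) ∷ [])
          (subst (n <_) (sym (ℕ.*-identityʳ (4 ^ L))) n<4^L))
        where open Search R R↗ s s-valid b S<b

      -- Each round works in the lowest rows left, so its result is still missing after the rows
      -- above, where the next round takes place. A round needs `len s < b`; once this fails, the
      -- path is already long enough.
      iterate : ∀ {r} → r ≡ 1 ⊎ L * suc r ≤ m → ∀ k {R s} → Sorted R → Valid s →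
                lastEdge s ∈ afterRows R (k * (L * (5 * b))) →
                ∃[ t ] Walk R s t × (b ≤ len t ⊎ len s + k * r ≤ len t)
      iterate _ zero {s = s} R↗ s-valid s∈ = s , ε , inj₂ (ℕ.≤-reflexive (ℕ.+-identityʳ (len s)))
      iterate {r} r-small (suc k) {R} {s} R↗ s-valid s∈ with b ℕ.≤? len s
      ... | yes b≤S = s , ε , inj₁ b≤S
      ... | no  b≰S with round r-small (afterRows-sorted R (k * d) R↗) s-valid (ℕ.≰⇒> b≰S)
                           (subst (lastEdge s ∈_)
                             (trans (cong (afterRows R) (ℕ.+-comm d (k * d))) (afterRows-+ R (k * d) d)) s∈)
        where
        d : ℕ
        d = L * (5 * b)
      ...   | t , W , s+r≤t with iterate r-small k R↗ (Walk-valid W s-valid)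
                                   (Walk-lastEdge W (afterRows-anti R (ℕ.m≤n+m _ (L * (5 * b))) s∈))
      ...     | t′ , W′ , inj₁ b≤t′    =
        t′ , Walk-mono (afterRows-⊆ R (k * (L * (5 * b)))) W ◅◅ W′ , inj₁ b≤t′
      ...     | t′ , W′ , inj₂ t+kr≤t′ =
        t′ , Walk-mono (afterRows-⊆ R (k * (L * (5 * b)))) W ◅◅ W′ , inj₂ (begin
        len s + (r + k * r)   ≡⟨ ℕ.+-assoc (len s) r (k * r) ⟨
        len s + r + k * r     ≤⟨ ℕ.+-monoˡ-≤ (k * r) s+r≤t ⟩
        len t + k * r         ≤⟨ t+kr≤t′ ⟩
        len t′                ∎)
        where open ℕ.≤-Reasoning

      -- 4Lz rounds of 5bL rows each.
      extend : ∀ z → z * m ≤ b → Extendible (4 * L * z * (L * (5 * b))) (z * m)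
      extend z zm≤b R R↗ {e} {x} {y} e∈ j = go (stride L m)
        where
        go : ∃[ r ] m ≤ r * (4 * L) × (r ≡ 1 ⊎ L * suc r ≤ m) →
             ∃[ t ] Walk R ⟨ e , y , x ∷ [] ⟩ t × z * m ≤ len t
        go (r , m≤ , r-small)
          with iterate r-small (4 * L * z) {s = ⟨ e , y , x ∷ [] ⟩} R↗
                 (proj₂ (Joins-∈ᴱ {e} j) , λ { (here y≡x) → Joins-≢ {e} j (sym y≡x) }) e∈
        ... | t , W , inj₁ b≤t  = t , W , ℕ.≤-trans zm≤b b≤t
        ... | t , W , inj₂ kr≤t = t , W , (begin
          z * m                 ≤⟨ ℕ.*-monoʳ-≤ z m≤ ⟩
          z * (r * (4 * L))     ≡⟨ rearrange z r L ⟩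
          4 * L * z * r         ≤⟨ ℕ.n≤1+n _ ⟩
          suc (4 * L * z * r)   ≤⟨ kr≤t ⟩
          len t                 ∎)
          where
          open ℕ.≤-Reasoning
          rearrange : ∀ z r L → z * (r * (4 * L)) ≡ 4 * L * z * r
          rearrange = solve-∀

    -- With `b` the row count for `t`, the `4 * L * z` rounds of `L * (5 * b)` rows multiply it by
    -- `z * (20 * (L * L))` and the length by `z`. For `t = 0` the edge alone has the length
    -- `z ^ 0 = 1`.
    extendible : ∀ z t → Extendible (z ^ suc t * (20 * (L * L)) ^ t) (z ^ t)
    extendible z zero    R R↗ e∈ j = _ , ε , ℕ.≤-refl
    extendible z (suc t) = subst (λ k → Extendible k (z ^ suc t))
      (sym (rows z L (z ^ suc t) ((20 * (L * L)) ^ t)))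
      (extend (z ^ suc t * (20 * (L * L)) ^ t) (z ^ t) (extendible z t) z
        (ℕ.m≤m*n (z ^ suc t) ((20 * (L * L)) ^ t) {{20L²^t≢0 L t}}))
      where
      rows : ∀ z L p q → z * p * (20 * (L * L) * q) ≡ 4 * L * z * (L * (5 * (p * q)))
      rows = solve-∀

  open IncreasingPath using (StartsWith; pathLength)

  long-path : ∀ L .{{_ : NonZero L}} → n < 4 ^ L → ∀ z t A e → A < height e →
    z ^ suc t * (20 * (L * L)) ^ t ≤ A →
    Σ[ P ∈ IncreasingPath G ] StartsWith P e × z ^ t ≤ pathLength P ×
      (∀ f → f ∈ IncreasingPath.edges P → height e ≤ height f + A)
  long-path L n<4^L z t A e A<h rows≤A = build (extendible L n<4^L z t R R↗ e∈ (inj₁ (refl , refl)))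
    where
    i : ℕ
    i = ℕ.pred (height e)
    R : List E
    -- As `A ≤ i`, the edge `e` is still missing after `A` more rows, while every edge of `R` has
    -- height at least `height e - A`; any path within `R` meets the height condition.
    R = left (i ℕ.∸ A)
    R↗ : Sorted R
    R↗ = subst Sorted (trans (sym (left-+ (i ℕ.∸ A) 0)) (cong left (ℕ.+-identityʳ (i ℕ.∸ A))))
           (afterRows-sorted _ (i ℕ.∸ A) edges-sorted)
    e∈R : e ∈ afterRows R A
    e∈R = subst (e ∈_) (trans (cong left (sym (ℕ.m+[n∸m]≡n (ℕ.s≤s⁻¹ A<h)))) (left-+ A (i ℕ.∸ A))) (∈-left e)
    e∈ : e ∈ afterRows R (z ^ suc t * (20 * (L * L)) ^ t)
    e∈ = afterRows-anti R rows≤A e∈R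
    low : ∀ {f} → f ∈ R → height e ≤ height f + A
    low {f} f∈ = ℕ.≤-trans (s≤s (ℕ.≤-trans (ℕ.m≤n+m∸n i A) (ℕ.≤-reflexive (ℕ.+-comm A (i ℕ.∸ A)))))
      (ℕ.+-monoˡ-≤ A (left⇒height {f = f} f∈))
    build : (∃[ s ] Walk R ⟨ e , hi e , lo e ∷ [] ⟩ s × z ^ t ≤ len s) → _
    build (s , W , z^t≤) with Walk⇒path W
    ... | vs , fs , T , ↗ , fs∈ , vs! , vs∉ , length≡ =
      record { vertices = lo e ∷ hi e ∷ vs ; first = e ; rest = fs ; traverses = inj₁ (refl , refl) ∷ T
             ; distinct = (Joins-≢ {e} (inj₁ (refl , refl)) ∷ All.map (λ x∉ lo≡x → x∉ (here (sym lo≡x))) vs∉) ∷ vs!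
             ; increasing = ↗ }
      , refl , ℕ.≤-trans z^t≤ (ℕ.≤-reflexive (trans (sym length≡) (ℕ.+-comm (length fs) 1)))
      , λ f f∈ → low (All.lookup (afterRows-⊆ R A e∈R ∷ fs∈) f∈)

theorem4p1 : (t : ℕ) .{{_ : NonZero t}} (n : ℕ) (2≤n : 2 ≤ n) (G : OrderedGraph n) →
    let open OrderedGraph G using (E)
        open HeightTable G using (height)
        open IncreasingPath
    in (a : ℝ₊) (e : E) → a <ᵣ fromℕ (height e) →
       Σ[ P ∈ IncreasingPath G ]
         StartsWith P e ×
         (a ^ℚ (1ℚ - + 1 / t)) /ᵣ ((fromℕ 70 *ᵣ log₂ n 2≤n) ^ᵣ (2 *ℕ t)) ≤ᵣ fromℕ (pathLength P) ×
         (∀ f → f ∈ edges P → fromℕ (height e) ≤ᵣ fromℕ (height f) +ᵣ a)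
theorem4p1 (suc t) n 2≤n G a e a<h =
  let L , L≢0 , 2^L≤n , n<4^L = log-window n 2≤n
      A , A<h , (p , A<p , Lp) , U2+A = integer-part a (HeightTable.height G e) a<h
      z , z≤A , A<z = root-floor ((20 * (L * L)) ^ t) {{20L²^t≢0 L t {{L≢0}}}} t A
      P , P-starts , z^t≤P , low = LongPaths.long-path G L {{L≢0}} n<4^L z t A e A<h z≤A
  -- The length bound compares `a` with `A + 2` from above and `70 log n` with `33 * L` from below;
  -- the height bound uses `A < p` with `p` below `a`.
  in P , P-starts
     , root-bound t a (fromℕ 70 *ᵣ log₂ n 2≤n) (2 *ℕ suc t) (IncreasingPath.pathLength P) U2+A
         (log-lower n 2≤n L {{L≢0}} 2^L≤n)
         (ι-power-slack L {{L≢0}} t {A} {z} {IncreasingPath.pathLength P} A<z z^t≤P)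
     , λ f f∈ → drop-bound a (HeightTable.height G e) (HeightTable.height G f) A<p Lp (low f f∈)
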